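{- For every integer $k\ge 0$, $$\frac{\pi}{2}=\arctan\left(\frac{L_{2k+1}}{2}\right)+2\arctan\left(\frac{1}{\phi^{2k+1}}\right).$$
   Context: $\phi=\frac{1+\sqrt5}{2}$ is the Golden mean. $(L_m)_{m\ge0}$ is the sequence of Lucas numbers: $L_0=2$, $L_1=1$, $L_m=L_{m-1}+L_{m-2}$ for $m\ge2$. -}

module Defs where

open import Data.Nat.Base as ℕ using (ℕ; zero; suc)
import Data.Nat.Properties as ℕₚ
import Data.Nat.Coprimality as Coprime
open import Data.Integer.Base as ℤ using (+_; +0; +[1+_])
import Data.Integer.Properties as ℤₚ
open import Data.Rational.Base
open import Data.Rational.Properties
open import Data.Rational.Solver using (module +-*-Solver)
open import Data.Product.Base using (∃; _×_; _,_; proj₁; proj₂)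
open import Data.Sum.Base using (inj₁; inj₂)
open import Relation.Nullary.Decidable.Core using (yes; no)
open import Relation.Binary.PropositionalEquality
open +-*-Solver using (solve; _:=_; _:+_; _:*_; _:-_; :-_; con)

------------------------------------------------------------------------
-- Rational arithmetic

-- The values of  + n / 1  and  + 1 / suc n, in normal form so that Agda does
-- not unfold the gcd computation of _/_ during unification.
fromℕ : ℕ → ℚ
fromℕ n = mkℚ (+ n) 0 (Coprime.sym (Coprime.1-coprimeTo n))

recip : ℕ → ℚ
recip n = mkℚ (+ 1) n (Coprime.1-coprimeTo (suc n))

fromℕ-/ : ∀ n → + n / 1 ≡ fromℕ n
fromℕ-/ n = normalize-coprime (Coprime.sym (Coprime.1-coprimeTo n))

fromℕ-+ : ∀ m n → fromℕ (m ℕ.+ n) ≡ fromℕ m + fromℕ n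
fromℕ-+ m n = trans (sym (fromℕ-/ (m ℕ.+ n)))
  (cong (_/ 1) (trans (ℤₚ.pos-+ m n)
    (sym (cong₂ ℤ._+_ (ℤₚ.*-identityʳ (+ m)) (ℤₚ.*-identityʳ (+ n))))))

fromℕ-* : ∀ m n → fromℕ (m ℕ.* n) ≡ fromℕ m * fromℕ n
fromℕ-* m n = trans (sym (fromℕ-/ (m ℕ.* n))) (cong (_/ 1) (ℤₚ.pos-* m n))

fromℕ-suc : ∀ n → fromℕ (suc n) ≡ 1ℚ + fromℕ n
fromℕ-suc = fromℕ-+ 1

fromℕ-mono-≤ : ∀ {m n} → m ℕ.≤ n → fromℕ m ≤ fromℕ n
fromℕ-mono-≤ m≤n = *≤* (ℤₚ.*-monoʳ-≤-nonNeg (+ 1) (ℤ.+≤+ m≤n))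

fromℕ-mono-< : ∀ {m n} → m ℕ.< n → fromℕ m < fromℕ n
fromℕ-mono-< m<n = *<* (ℤₚ.*-monoʳ-<-pos (+ 1) (ℤ.+<+ m<n))

0≤fromℕ : ∀ n → 0ℚ ≤ fromℕ n
0≤fromℕ n = fromℕ-mono-≤ ℕ.z≤n

fromℕ*recip : ∀ n → fromℕ (suc n) * recip n ≡ 1ℚ
fromℕ*recip n = *-inverseʳ (fromℕ (suc n))

0<recip : ∀ n → 0ℚ < recip n
0<recip n = positive⁻¹ (recip n)

0≤-* : ∀ {p q} → 0ℚ ≤ p → 0ℚ ≤ q → 0ℚ ≤ p * q
0≤-* {p} {q} 0≤p 0≤q =
  nonNegative⁻¹ (p * q) {{nonNeg*nonNeg⇒nonNeg p {{nonNegative 0≤p}} q {{nonNegative 0≤q}}}}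

0<-* : ∀ {p q} → 0ℚ < p → 0ℚ < q → 0ℚ < p * q
0<-* {p} {q} 0<p 0<q =
  positive⁻¹ (p * q) {{pos*pos⇒pos p {{positive 0<p}} q {{positive 0<q}}}}

0<-+ : ∀ {p q} → 0ℚ < p → 0ℚ < q → 0ℚ < p + q
0<-+ 0<p 0<q = +-mono-< 0<p 0<q

0≤-+ : ∀ {p q} → 0ℚ ≤ p → 0ℚ ≤ q → 0ℚ ≤ p + q
0≤-+ 0≤p 0≤q = +-mono-≤ 0≤p 0≤q

*-mono-≤ : ∀ {p q r s} → 0ℚ ≤ p → 0ℚ ≤ s → p ≤ q → r ≤ s → p * r ≤ q * s
*-mono-≤ {p} {q} {r} {s} 0≤p 0≤s p≤q r≤s =
  ≤-trans (*-monoˡ-≤-nonNeg p {{nonNegative 0≤p}} r≤s)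
          (*-monoʳ-≤-nonNeg s {{nonNegative 0≤s}} p≤q)

0<1/ : ∀ p .{{_ : NonZero p}} → 0ℚ < p → 0ℚ < 1/ p
0<1/ p@(mkℚ +[1+ _ ] _ _) _ = positive⁻¹ (1/ p)
0<1/ (mkℚ ℤ.-[1+ _ ] _ _) (*<* ())

0<½ : ∀ {ε} → 0ℚ < ε → 0ℚ < ½ * ε
0<½ 0<ε = 0<-* (positive⁻¹ ½) 0<ε

½+½ : ∀ ε → ½ * ε + ½ * ε ≡ ε
½+½ ε = trans (sym (*-distribʳ-+ ε ½ ½)) (*-identityˡ ε)

∣-∣-comm : ∀ p q → ∣ p - q ∣ ≡ ∣ q - p ∣
∣-∣-comm p q = trans (sym (∣-p∣≡∣p∣ (p - q)))
  (cong ∣_∣ (solve 2 (λ p q → :- (p :- q) := q :- p) refl p q))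

∣-∣-triangle : ∀ p q r → ∣ p - r ∣ ≤ ∣ p - q ∣ + ∣ q - r ∣
∣-∣-triangle p q r = subst (λ x → ∣ x ∣ ≤ ∣ p - q ∣ + ∣ q - r ∣)
  (solve 3 (λ p q r → (p :- q) :+ (q :- r) := p :- r) refl p q r)
  (∣p+q∣≤∣p∣+∣q∣ (p - q) (q - r))

∣∣-≤ : ∀ {p b} → p ≤ b → - p ≤ b → ∣ p ∣ ≤ b
∣∣-≤ {p} {b} p≤b -p≤b with ∣p∣≡p∨∣p∣≡-p p
... | inj₁ eq = subst (_≤ b) (sym eq) p≤b
... | inj₂ eq = subst (_≤ b) (sym eq) -p≤b

∣∣-square : ∀ p → ∣ p ∣ * ∣ p ∣ ≡ p * p
∣∣-square p with ∣p∣≡p∨∣p∣≡-p p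
... | inj₁ eq = cong₂ _*_ eq eq
... | inj₂ eq = trans (cong₂ _*_ eq eq) (solve 1 (λ p → (:- p) :* (:- p) := p :* p) refl p)

0≤p² : ∀ p → 0ℚ ≤ p * p
0≤p² p = subst (0ℚ ≤_) (∣∣-square p) (0≤-* (0≤∣p∣ p) (0≤∣p∣ p))

archimedean : ∀ p → ∃ λ N → p ≤ fromℕ N
archimedean p@(mkℚ (+ n) d c) = n , lemma
  where
  lemma : p ≤ fromℕ n
  lemma = *≤* (ℤₚ.*-monoˡ-≤-nonNeg (+ n) {{_}} (ℤ.+≤+ (ℕ.s≤s ℕ.z≤n)))
archimedean p@(mkℚ (ℤ.-[1+ n ]) d c) = 0 , *≤* ℤ.-≤+

recip-eventually-< : ∀ B {ε} → 0ℚ ≤ B → 0ℚ < ε →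
                     ∃ λ N → ∀ n → N ℕ.≤ n → B * recip n < ε
recip-eventually-< B {ε} 0≤B 0<ε = N , bound
  where
  instance
    ε≢0 : NonZero ε
    ε≢0 = >-nonZero 0<ε
  q = B * 1/ ε
  N = proj₁ (archimedean q)
  bound : ∀ n → N ℕ.≤ n → B * recip n < ε
  bound n N≤n = subst₂ _<_ lhs rhs
    (*-monoʳ-<-pos ε {{positive 0<ε}}
      (*-monoˡ-<-pos (recip n) {{positive (0<recip n)}}
        (≤-<-trans (proj₂ (archimedean q)) (fromℕ-mono-< (ℕ.s≤s N≤n)))))
    where
    lhs : ε * (q * recip n) ≡ B * recip n
    lhs = trans
      (solve 4 (λ e b i r → e :* ((b :* i) :* r) := (e :* i) :* (b :* r)) refl ε B (1/ ε) (recip n))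
      (trans (cong (_* (B * recip n)) (*-inverseʳ ε)) (*-identityˡ _))
    rhs : ε * (fromℕ (suc n) * recip n) ≡ ε
    rhs = trans (cong (ε *_) (fromℕ*recip n)) (*-identityʳ ε)

------------------------------------------------------------------------
-- Real numbers: Cauchy sequences of rationals, compared by _≃ᵣ_

record ℝ : Set where
  constructor mkℝ
  field
    seq    : ℕ → ℚ
    cauchy : ∀ ε → 0ℚ < ε → ∃ λ N → ∀ m n → N ℕ.≤ m → N ℕ.≤ n → ∣ seq m - seq n ∣ < ε

open ℝ public

infix  4 _≃ᵣ_
infixl 6 _+ᵣ_
infixl 7 _*ᵣ_
infixr 8 _^ᵣ_
infix  8 1/ᵣ_

_≃ᵣ_ : ℝ → ℝ → Set
x ≃ᵣ y = ∀ ε → 0ℚ < ε → ∃ λ N → ∀ n → N ℕ.≤ n → ∣ seq x n - seq y n ∣ < ε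

fromℚ : ℚ → ℝ
fromℚ q = mkℝ (λ _ → q) λ ε 0<ε → 0 , λ _ _ _ _ →
  subst (λ d → ∣ d ∣ < ε) (sym (+-inverseʳ q)) 0<ε

_+ᵣ_ : ℝ → ℝ → ℝ
x +ᵣ y = mkℝ (λ n → seq x n + seq y n) λ ε 0<ε →
  let (N₁ , h₁) = cauchy x (½ * ε) (0<½ 0<ε)
      (N₂ , h₂) = cauchy y (½ * ε) (0<½ 0<ε)
  in N₁ ℕ.⊔ N₂ , λ m n N≤m N≤n →
     ≤-<-trans
       (subst (λ d → ∣ d ∣ ≤ ∣ seq x m - seq x n ∣ + ∣ seq y m - seq y n ∣)
         (solve 4 (λ a b c d → (a :- b) :+ (c :- d) := (a :+ c) :- (b :+ d)) refl
           (seq x m) (seq x n) (seq y m) (seq y n))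
         (∣p+q∣≤∣p∣+∣q∣ (seq x m - seq x n) (seq y m - seq y n)))
       (subst (∣ seq x m - seq x n ∣ + ∣ seq y m - seq y n ∣ <_) (½+½ ε)
         (+-mono-< (h₁ m n (ℕₚ.m⊔n≤o⇒m≤o N₁ N₂ N≤m) (ℕₚ.m⊔n≤o⇒m≤o N₁ N₂ N≤n))
                   (h₂ m n (ℕₚ.m⊔n≤o⇒n≤o N₁ N₂ N≤m) (ℕₚ.m⊔n≤o⇒n≤o N₁ N₂ N≤n))))

EventuallyBounded : ℝ → Set
EventuallyBounded x = ∃ λ B → 0ℚ < B × ∃ λ N → ∀ n → N ℕ.≤ n → ∣ seq x n ∣ ≤ B

eventually-bounded : ∀ x → EventuallyBounded x
eventually-bounded x with cauchy x 1ℚ (positive⁻¹ 1ℚ)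
... | N , h = 1ℚ + ∣ seq x N ∣
            , +-mono-<-≤ (positive⁻¹ 1ℚ) (0≤∣p∣ (seq x N))
            , N , λ n N≤n → ≤-trans
                (subst (λ d → ∣ d ∣ ≤ ∣ seq x n - seq x N ∣ + ∣ seq x N ∣)
                  (solve 2 (λ a b → (a :- b) :+ b := a) refl (seq x n) (seq x N))
                  (∣p+q∣≤∣p∣+∣q∣ (seq x n - seq x N) (seq x N)))
                (+-monoˡ-≤ ∣ seq x N ∣ (<⇒≤ (h n N N≤n ℕₚ.≤-refl)))

_*ᵣ_ : ℝ → ℝ → ℝ
x *ᵣ y = mkℝ (λ n → seq x n * seq y n) (*-cauchy (eventually-bounded x) (eventually-bounded y))
  where
  *-cauchy : EventuallyBounded x → EventuallyBounded y →
             ∀ ε → 0ℚ < ε → ∃ λ N → ∀ m n → N ℕ.≤ m → N ℕ.≤ n →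
             ∣ seq x m * seq y m - seq x n * seq y n ∣ < ε
  *-cauchy (A , 0<A , N₁ , hA) (B , 0<B , N₂ , hB) ε 0<ε = N , bound
    where
    instance
      A≢0 : NonZero A
      A≢0 = >-nonZero 0<A
      B≢0 : NonZero B
      B≢0 = >-nonZero 0<B
    0<1/A : 0ℚ < 1/ A
    0<1/A = 0<1/ A 0<A
    0<1/B : 0ℚ < 1/ B
    0<1/B = 0<1/ B 0<B
    cy = cauchy y (½ * ε * 1/ A) (0<-* (0<½ 0<ε) 0<1/A)
    cx = cauchy x (½ * ε * 1/ B) (0<-* (0<½ 0<ε) 0<1/B)
    N = (N₁ ℕ.⊔ N₂) ℕ.⊔ (proj₁ cy ℕ.⊔ proj₁ cx)
    cancel : ∀ C .{{_ : NonZero C}} → C * (½ * ε * 1/ C) ≡ ½ * ε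
    cancel C = trans (solve 3 (λ c e i → c :* (e :* i) := (c :* i) :* e) refl C (½ * ε) (1/ C))
      (trans (cong (_* (½ * ε)) (*-inverseʳ C)) (*-identityˡ _))
    part : ∀ C u d .{{_ : NonZero C}} → 0ℚ < C → ∣ u ∣ ≤ C → ∣ d ∣ < ½ * ε * 1/ C →
           ∣ u * d ∣ < ½ * ε
    part C u d 0<C u≤C d< = subst₂ _<_ (sym (∣p*q∣≡∣p∣*∣q∣ u d)) (cancel C)
      (≤-<-trans (*-monoʳ-≤-nonNeg ∣ d ∣ {{∣-∣-nonNeg d}} u≤C) (*-monoʳ-<-pos C {{positive 0<C}} d<))
    bound : ∀ m n → N ℕ.≤ m → N ℕ.≤ n → ∣ seq x m * seq y m - seq x n * seq y n ∣ < ε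
    bound m n N≤m N≤n =
      subst₂ (λ d e → ∣ d ∣ < e)
        (solve 4 (λ a b c d → a :* (c :- d) :+ d :* (a :- b) := a :* c :- b :* d) refl
          (seq x m) (seq x n) (seq y m) (seq y n))
        (½+½ ε)
        (≤-<-trans (∣p+q∣≤∣p∣+∣q∣ (seq x m * (seq y m - seq y n)) (seq y n * (seq x m - seq x n)))
          (+-mono-< (part A (seq x m) (seq y m - seq y n) 0<A (hA m (left₁ N≤m)) (proj₂ cy m n (left₂ N≤m) (left₂ N≤n)))
                    (part B (seq y n) (seq x m - seq x n) 0<B (hB n (right₁ N≤n)) (proj₂ cx m n (right₂ N≤m) (right₂ N≤n)))))
      where
      left₁ : ∀ {k} → N ℕ.≤ k → N₁ ℕ.≤ k
      left₁ le = ℕₚ.m⊔n≤o⇒m≤o N₁ N₂ (ℕₚ.m⊔n≤o⇒m≤o (N₁ ℕ.⊔ N₂) _ le)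
      right₁ : ∀ {k} → N ℕ.≤ k → N₂ ℕ.≤ k
      right₁ le = ℕₚ.m⊔n≤o⇒n≤o N₁ N₂ (ℕₚ.m⊔n≤o⇒m≤o (N₁ ℕ.⊔ N₂) _ le)
      left₂ : ∀ {k} → N ℕ.≤ k → proj₁ cy ℕ.≤ k
      left₂ le = ℕₚ.m⊔n≤o⇒m≤o (proj₁ cy) (proj₁ cx) (ℕₚ.m⊔n≤o⇒n≤o (N₁ ℕ.⊔ N₂) _ le)
      right₂ : ∀ {k} → N ℕ.≤ k → proj₁ cx ℕ.≤ k
      right₂ le = ℕₚ.m⊔n≤o⇒n≤o (proj₁ cy) (proj₁ cx) (ℕₚ.m⊔n≤o⇒n≤o (N₁ ℕ.⊔ N₂) _ le)

_^ᵣ_ : ℝ → ℕ → ℝ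
x ^ᵣ zero  = fromℚ 1ℚ
x ^ᵣ suc n = x *ᵣ (x ^ᵣ n)

-- Positivity is data (a rational lower bound valid from some index on); it is
-- what makes the sequence of reciprocals Cauchy.
record Positiveᵣ (x : ℝ) : Set where
  constructor mkPositive
  field
    lower       : ℚ
    lower-pos   : 0ℚ < lower
    start       : ℕ
    lower-bound : ∀ n → start ℕ.≤ n → lower ≤ seq x n

*-positive : ∀ {x y} → Positiveᵣ x → Positiveᵣ y → Positiveᵣ (x *ᵣ y)
*-positive (mkPositive a 0<a M hx) (mkPositive b 0<b N hy) =
  mkPositive (a * b) (0<-* 0<a 0<b) (M ℕ.⊔ N) λ n le →
    let b≤ = hy n (ℕₚ.m⊔n≤o⇒n≤o M N le) in
    *-mono-≤ (<⇒≤ 0<a) (≤-trans (<⇒≤ 0<b) b≤) (hx n (ℕₚ.m⊔n≤o⇒m≤o M N le)) b≤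

^-positive : ∀ {x} n → Positiveᵣ x → Positiveᵣ (x ^ᵣ n)
^-positive     zero    p = mkPositive 1ℚ (positive⁻¹ 1ℚ) 0 λ _ _ → ≤-refl
^-positive {x} (suc n) p = *-positive {x} {x ^ᵣ n} p (^-positive n p)

-- Reciprocal on ℚ, extended by inv 0 = 0 so that it can be applied to the
-- finitely many vanishing terms of a sequence with positive limit.
inv : ℚ → ℚ
inv   (mkℚ +0         _ _) = 0ℚ
inv p@(mkℚ +[1+ _ ]   _ _) = 1/ p
inv p@(mkℚ ℤ.-[1+ _ ] _ _) = 1/ p

inv-inverseʳ : ∀ {p} → 0ℚ < p → p * inv p ≡ 1ℚ
inv-inverseʳ {mkℚ +0           _ _} (*<* (ℤ.+<+ ()))
inv-inverseʳ {p@(mkℚ +[1+ _ ] _ _)} _ = *-inverseʳ p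
inv-inverseʳ {mkℚ ℤ.-[1+ _ ]   _ _} (*<* ())

inv-pos : ∀ {p} → 0ℚ < p → 0ℚ < inv p
inv-pos {mkℚ +0           _ _} (*<* (ℤ.+<+ ()))
inv-pos {p@(mkℚ +[1+ _ ] _ _)} 0<p = 0<1/ p 0<p
inv-pos {mkℚ ℤ.-[1+ _ ]   _ _} (*<* ())

inv-anti-≤ : ∀ {p q} → 0ℚ < p → p ≤ q → inv q ≤ inv p
inv-anti-≤ {p} {q} 0<p p≤q = subst₂ _≤_ lhs rhs
  (*-monoʳ-≤-nonNeg (inv p * inv q) {{nonNegative (0≤-* (<⇒≤ (inv-pos 0<p)) (<⇒≤ (inv-pos 0<q)))}} p≤q)
  where
  0<q = <-≤-trans 0<p p≤q
  lhs : p * (inv p * inv q) ≡ inv q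
  lhs = trans (sym (*-assoc p (inv p) (inv q)))
    (trans (cong (_* inv q) (inv-inverseʳ 0<p)) (*-identityˡ _))
  rhs : q * (inv p * inv q) ≡ inv p
  rhs = trans (solve 3 (λ q a b → q :* (a :* b) := (q :* b) :* a) refl q (inv p) (inv q))
    (trans (cong (_* inv p) (inv-inverseʳ 0<q)) (*-identityˡ _))

1/ᵣ_ : (x : ℝ) → {{Positiveᵣ x}} → ℝ
1/ᵣ_ x {{mkPositive δ 0<δ M h}} = mkℝ (λ n → inv (seq x n)) inv-cauchy
  where
  inv-diff : ∀ {p q} → 0ℚ < p → 0ℚ < q → inv p - inv q ≡ (inv p * inv q) * (q - p)
  inv-diff {p} {q} 0<p 0<q = sym (trans
    (solve 4 (λ p q a b → (a :* b) :* (q :- p) := a :* (q :* b) :- b :* (p :* a)) refl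
      p q (inv p) (inv q))
    (cong₂ _-_ (trans (cong (inv p *_) (inv-inverseʳ 0<q)) (*-identityʳ (inv p)))
               (trans (cong (inv q *_) (inv-inverseʳ 0<p)) (*-identityʳ (inv q)))))

  inv-cauchy : ∀ ε → 0ℚ < ε → ∃ λ N → ∀ m n → N ℕ.≤ m → N ℕ.≤ n →
               ∣ inv (seq x m) - inv (seq x n) ∣ < ε
  inv-cauchy ε 0<ε = M ℕ.⊔ proj₁ cx , bound
    where
    0<ε' : 0ℚ < (δ * δ) * ε
    0<ε' = 0<-* (0<-* 0<δ 0<δ) 0<ε
    cx = cauchy x ((δ * δ) * ε) 0<ε'
    K = inv δ * inv δ
    0<K : 0ℚ < K
    0<K = 0<-* (inv-pos 0<δ) (inv-pos 0<δ)
    K*ε' : K * ((δ * δ) * ε) ≡ ε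
    K*ε' = trans
      (solve 3 (λ d i e → (i :* i) :* ((d :* d) :* e) := (d :* i) :* ((d :* i) :* e)) refl δ (inv δ) ε)
      (trans (cong₂ (λ a b → a * (b * ε)) (inv-inverseʳ 0<δ) (inv-inverseʳ 0<δ))
             (trans (*-identityˡ _) (*-identityˡ _)))
    bound : ∀ m n → M ℕ.⊔ proj₁ cx ℕ.≤ m → M ℕ.⊔ proj₁ cx ℕ.≤ n →
            ∣ inv (seq x m) - inv (seq x n) ∣ < ε
    bound m n le-m le-n = subst₂ _<_ (sym eq) K*ε'
      (≤-<-trans (*-monoʳ-≤-nonNeg ∣ q - p ∣ {{∣-∣-nonNeg (q - p)}} K-bound)
        (*-monoʳ-<-pos K {{positive 0<K}}
          (proj₂ cx n m (ℕₚ.m⊔n≤o⇒n≤o M _ le-n) (ℕₚ.m⊔n≤o⇒n≤o M _ le-m))))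
      where
      p = seq x m
      q = seq x n
      δ≤p : δ ≤ p
      δ≤p = h m (ℕₚ.m⊔n≤o⇒m≤o M _ le-m)
      δ≤q : δ ≤ q
      δ≤q = h n (ℕₚ.m⊔n≤o⇒m≤o M _ le-n)
      0<p = <-≤-trans 0<δ δ≤p
      0<q = <-≤-trans 0<δ δ≤q
      0≤pq : 0ℚ ≤ inv p * inv q
      0≤pq = 0≤-* (<⇒≤ (inv-pos 0<p)) (<⇒≤ (inv-pos 0<q))
      K-bound : inv p * inv q ≤ K
      K-bound = *-mono-≤ (<⇒≤ (inv-pos 0<p)) (<⇒≤ (inv-pos 0<δ)) (inv-anti-≤ 0<δ δ≤p) (inv-anti-≤ 0<δ δ≤q)
      eq : ∣ inv p - inv q ∣ ≡ (inv p * inv q) * ∣ q - p ∣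
      eq = trans (cong ∣_∣ (inv-diff 0<p 0<q))
        (trans (∣p*q∣≡∣p∣*∣q∣ (inv p * inv q) (q - p))
               (cong (_* ∣ q - p ∣) (0≤p⇒∣p∣≡p 0≤pq)))

------------------------------------------------------------------------
-- Square roots of natural numbers and the golden mean

-- ⌊√n⌋
isqrt : ℕ → ℕ
isqrt zero = 0
isqrt (suc n) with suc (isqrt n) ℕ.* suc (isqrt n) ℕₚ.≤? suc n
... | yes _ = suc (isqrt n)
... | no  _ = isqrt n

isqrt-spec : ∀ n → isqrt n ℕ.* isqrt n ℕ.≤ n × n ℕ.< suc (isqrt n) ℕ.* suc (isqrt n)
isqrt-spec zero = ℕ.z≤n , ℕ.s≤s ℕ.z≤n
isqrt-spec (suc n) with suc (isqrt n) ℕ.* suc (isqrt n) ℕₚ.≤? suc n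
... | yes le = le , ℕₚ.≤-<-trans (proj₂ (isqrt-spec n))
                      (ℕₚ.*-mono-< (ℕₚ.n<1+n (suc (isqrt n))) (ℕₚ.n<1+n (suc (isqrt n))))
... | no ≰ = ℕₚ.m≤n⇒m≤1+n (proj₁ (isqrt-spec n)) , ℕₚ.≰⇒> ≰

square-cancel-< : ∀ a b → a ℕ.* a ℕ.< b ℕ.* b → a ℕ.< b
square-cancel-< a b lt with a ℕₚ.<? b
... | yes a<b = a<b
... | no a≮b with () ← ℕₚ.<⇒≱ lt (ℕₚ.*-mono-≤ (ℕₚ.≮⇒≥ a≮b) (ℕₚ.≮⇒≥ a≮b))

√-approx : ℕ → ℕ → ℚ
√-approx k n = fromℕ (isqrt (k ℕ.* (suc n ℕ.* suc n))) * recip n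

√-approx-< : ∀ k m n → √-approx k m < √-approx k n + recip n
√-approx-< k m n = subst₂ _<_ lhs rhs
  (*-monoˡ-<-pos (recip m * recip n) {{positive (0<-* (0<recip m) (0<recip n))}}
    (fromℕ-mono-< (square-cancel-< (a ℕ.* suc n) (suc b ℕ.* suc m) squares)))
  where
  a = isqrt (k ℕ.* (suc m ℕ.* suc m))
  b = isqrt (k ℕ.* (suc n ℕ.* suc n))
  swap : ∀ s t → (s ℕ.* t) ℕ.* (s ℕ.* t) ≡ (s ℕ.* s) ℕ.* (t ℕ.* t)
  swap s t = ℕₚ.[m*n]*[o*p]≡[m*o]*[n*p] s t s t
  middle : (k ℕ.* (suc m ℕ.* suc m)) ℕ.* (suc n ℕ.* suc n) ≡
           (k ℕ.* (suc n ℕ.* suc n)) ℕ.* (suc m ℕ.* suc m)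
  middle = trans (ℕₚ.*-assoc k _ _)
    (trans (cong (k ℕ.*_) (ℕₚ.*-comm (suc m ℕ.* suc m) (suc n ℕ.* suc n))) (sym (ℕₚ.*-assoc k _ _)))
  squares : (a ℕ.* suc n) ℕ.* (a ℕ.* suc n) ℕ.< (suc b ℕ.* suc m) ℕ.* (suc b ℕ.* suc m)
  squares = subst₂ ℕ._<_ (sym (swap a (suc n))) (sym (swap (suc b) (suc m)))
    (ℕₚ.≤-<-trans
      (ℕₚ.*-monoˡ-≤ (suc n ℕ.* suc n) (proj₁ (isqrt-spec (k ℕ.* (suc m ℕ.* suc m)))))
      (subst (ℕ._< (suc b ℕ.* suc b) ℕ.* (suc m ℕ.* suc m)) (sym middle)
        (ℕₚ.*-monoˡ-< (suc m ℕ.* suc m) (proj₂ (isqrt-spec (k ℕ.* (suc n ℕ.* suc n)))))))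
  lhs : fromℕ (a ℕ.* suc n) * (recip m * recip n) ≡ √-approx k m
  lhs = trans (cong (_* (recip m * recip n)) (fromℕ-* a (suc n)))
    (trans (solve 4 (λ a N r s → (a :* N) :* (r :* s) := (a :* r) :* (N :* s)) refl
             (fromℕ a) (fromℕ (suc n)) (recip m) (recip n))
      (trans (cong (√-approx k m *_) (fromℕ*recip n)) (*-identityʳ _)))
  rhs : fromℕ (suc b ℕ.* suc m) * (recip m * recip n) ≡ √-approx k n + recip n
  rhs = trans (cong (_* (recip m * recip n))
                (trans (fromℕ-* (suc b) (suc m)) (cong (_* fromℕ (suc m)) (fromℕ-suc b))))
    (trans (solve 4 (λ b M r s → ((con 1ℚ :+ b) :* M) :* (r :* s) := (b :* s :+ s) :* (M :* r)) refl
             (fromℕ b) (fromℕ (suc m)) (recip m) (recip n))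
      (trans (cong ((√-approx k n + recip n) *_) (fromℕ*recip m)) (*-identityʳ _)))

-- The n-th approximation of √ k is ⌊(n+1)√k⌋/(n+1).
√_ : ℕ → ℝ
√ k = mkℝ (√-approx k) √-cauchy
  where
  cancel-+ : ∀ {p q r} → p < q + r → p - q ≤ r
  cancel-+ {p} {q} {r} lt = subst (p - q ≤_)
    (solve 2 (λ q r → (q :+ r) :- q := r) refl q r) (+-monoˡ-≤ (- q) (<⇒≤ lt))
  √-cauchy : ∀ ε → 0ℚ < ε → ∃ λ N → ∀ m n → N ℕ.≤ m → N ℕ.≤ n →
             ∣ √-approx k m - √-approx k n ∣ < ε
  √-cauchy ε 0<ε = N , λ m n N≤m N≤n →
    ≤-<-trans
      (∣∣-≤
        (≤-trans (cancel-+ {√-approx k m} {√-approx k n} (√-approx-< k m n)) (p≤p⊔q (recip n) (recip m)))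
        (≤-trans
          (subst (_≤ recip m)
            (solve 2 (λ p q → q :- p := :- (p :- q)) refl (√-approx k m) (√-approx k n))
            (cancel-+ {√-approx k n} {√-approx k m} (√-approx-< k n m)))
          (p≤q⊔p (recip n) (recip m))))
      (⊔-lub-< {recip n} {recip m} (small n N≤n) (small m N≤m))
    where
    N = proj₁ (recip-eventually-< 1ℚ (nonNegative⁻¹ 1ℚ) 0<ε)
    small : ∀ n → N ℕ.≤ n → recip n < ε
    small n le = subst (_< ε) (*-identityˡ (recip n))
      (proj₂ (recip-eventually-< 1ℚ (nonNegative⁻¹ 1ℚ) 0<ε) n le)
    ⊔-lub-< : ∀ {p q} → p < ε → q < ε → p ⊔ q < ε
    ⊔-lub-< {p} {q} p< q< with ⊔-sel p q
    ... | inj₁ eq = subst (_< ε) (sym eq) p<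
    ... | inj₂ eq = subst (_< ε) (sym eq) q<

φ : ℝ
φ = fromℚ ½ *ᵣ (fromℚ 1ℚ +ᵣ √ 5)

φ-positive : Positiveᵣ φ
φ-positive = mkPositive ½ (positive⁻¹ ½) 0 λ n _ →
  subst (_≤ ½ * (1ℚ + √-approx 5 n)) (*-identityʳ ½)
    (*-monoˡ-≤-nonNeg ½
      (subst (_≤ 1ℚ + √-approx 5 n) (+-identityʳ 1ℚ)
        (+-monoʳ-≤ 1ℚ (0≤-* (0≤fromℕ (isqrt (5 ℕ.* (suc n ℕ.* suc n)))) (<⇒≤ (0<recip n))))))

instance
  φ^n-positive : ∀ {n} → Positiveᵣ (φ ^ᵣ n)
  φ^n-positive {n} = ^-positive n φ-positive

lucas : ℕ → ℕ
lucas zero          = 2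
lucas (suc zero)    = 1
lucas (suc (suc n)) = lucas (suc n) ℕ.+ lucas n

------------------------------------------------------------------------
-- The arctangent: arctan x is the angle in (-π/2, π/2) whose tangent is x,
-- angles being measured by arc length on the unit circle.

Σ< : ℕ → (ℕ → ℚ) → ℚ
Σ< zero    f = 0ℚ
Σ< (suc n) f = Σ< n f + f n

syntax Σ< n (λ i → e) = Σ[ i < n ] e

0<1+t² : ∀ t → 0ℚ < 1ℚ + t * t
0<1+t² t = +-mono-<-≤ (positive⁻¹ 1ℚ) (0≤p² t)

-- The right half of the unit circle is parametrised by slope as
-- t ↦ (1, t)/√(1+t²), with speed 1/(1+t²). The signed arc length from (1, 0)
-- to the point of slope x is therefore ∫₀ˣ dt/(1+t²), which defines arctan x.
arctan′ : ℚ → ℚ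
arctan′ t = (1/ (1ℚ + t * t)) {{>-nonZero (0<1+t² t)}}

-- Left Riemann sum of 1/(1+t²) over [0, n·h] with n steps of length h
-- (h may be negative).
riemann : ℕ → ℚ → ℚ
riemann n h = Σ[ i < n ] (h * arctan′ (fromℕ i * h))

arctan-approx : ℕ → ℚ → ℚ
arctan-approx n q = riemann (suc n) (q * recip n)

Σ-cong : ∀ n {f g} → (∀ i → f i ≡ g i) → Σ< n f ≡ Σ< n g
Σ-cong zero    eq = refl
Σ-cong (suc n) eq = cong₂ _+_ (Σ-cong n eq) (eq n)

Σ-split : ∀ m n f → Σ< (m ℕ.+ n) f ≡ Σ< m f + Σ[ j < n ] f (m ℕ.+ j)
Σ-split m zero f = trans (cong (λ k → Σ< k f) (ℕₚ.+-identityʳ m)) (sym (+-identityʳ _))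
Σ-split m (suc n) f = trans (cong (λ k → Σ< k f) (ℕₚ.+-suc m n))
  (trans (cong (_+ f (m ℕ.+ n)) (Σ-split m n f)) (+-assoc (Σ< m f) _ _))

Σ-blocks : ∀ n M f → Σ< (n ℕ.* M) f ≡ Σ[ i < n ] (Σ[ j < M ] f (i ℕ.* M ℕ.+ j))
Σ-blocks zero    M f = refl
Σ-blocks (suc n) M f = trans (cong (λ k → Σ< k f) (ℕₚ.+-comm M (n ℕ.* M)))
  (trans (Σ-split (n ℕ.* M) M f) (cong (_+ Σ[ j < M ] f (n ℕ.* M ℕ.+ j)) (Σ-blocks n M f)))

Σ-const : ∀ n c → Σ[ i < n ] c ≡ fromℕ n * c
Σ-const zero    c = sym (*-zeroˡ c)
Σ-const (suc n) c = trans (cong (_+ c) (Σ-const n c))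
  (trans (solve 2 (λ n c → n :* c :+ c := (con 1ℚ :+ n) :* c) refl (fromℕ n) c)
         (cong (_* c) (sym (fromℕ-suc n))))

Σ-diff : ∀ n {f g c} → (∀ i → i ℕ.< n → ∣ f i - g i ∣ ≤ c) → ∣ Σ< n f - Σ< n g ∣ ≤ fromℕ n * c
Σ-diff zero {c = c} h = ≤-reflexive (sym (*-zeroˡ c))
Σ-diff (suc n) {f} {g} {c} h =
  subst₂ (λ d e → ∣ d ∣ ≤ e)
    (solve 4 (λ a b c d → (a :- b) :+ (c :- d) := (a :+ c) :- (b :+ d)) refl
      (Σ< n f) (Σ< n g) (f n) (g n))
    (trans (solve 2 (λ n c → n :* c :+ c := (con 1ℚ :+ n) :* c) refl (fromℕ n) c)
           (cong (_* c) (sym (fromℕ-suc n))))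
    (≤-trans (∣p+q∣≤∣p∣+∣q∣ (Σ< n f - Σ< n g) (f n - g n))
      (+-mono-≤ (Σ-diff n (λ i i<n → h i (ℕₚ.m≤n⇒m≤1+n i<n))) (h n ℕₚ.≤-refl)))

arctan′-inverse : ∀ t → (1ℚ + t * t) * arctan′ t ≡ 1ℚ
arctan′-inverse t = *-inverseʳ (1ℚ + t * t) {{>-nonZero (0<1+t² t)}}

0<arctan′ : ∀ t → 0ℚ < arctan′ t
0<arctan′ t = 0<1/ (1ℚ + t * t) {{>-nonZero (0<1+t² t)}} (0<1+t² t)

∣arctan′∣ : ∀ t → ∣ arctan′ t ∣ ≡ arctan′ t
∣arctan′∣ t = 0≤p⇒∣p∣≡p (<⇒≤ (0<arctan′ t))

≤1+t²⇒ : ∀ t {a} → a ≤ 1ℚ + t * t → a * arctan′ t ≤ 1ℚ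
≤1+t²⇒ t {a} le = subst (a * arctan′ t ≤_) (arctan′-inverse t)
  (*-monoʳ-≤-nonNeg (arctan′ t) {{nonNegative (<⇒≤ (0<arctan′ t))}} le)

arctan′≤1 : ∀ t → arctan′ t ≤ 1ℚ
arctan′≤1 t = subst (_≤ 1ℚ) (*-identityˡ _) (≤1+t²⇒ t
  (subst (_≤ 1ℚ + t * t) (+-identityʳ 1ℚ) (+-monoʳ-≤ 1ℚ (0≤p² t))))

∣t∣≤1+t² : ∀ t → ∣ t ∣ ≤ 1ℚ + t * t
∣t∣≤1+t² t with ≤-total ∣ t ∣ 1ℚ
... | inj₁ le = ≤-trans le (subst (_≤ 1ℚ + t * t) (+-identityʳ 1ℚ) (+-monoʳ-≤ 1ℚ (0≤p² t)))
... | inj₂ ge = subst₂ _≤_ (trans (+-identityˡ _) (*-identityˡ ∣ t ∣)) (cong (_+_ 1ℚ) (∣∣-square t))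
  (+-mono-≤ (nonNegative⁻¹ 1ℚ) (*-monoʳ-≤-nonNeg ∣ t ∣ {{∣-∣-nonNeg t}} ge))

∣t*arctan′∣≤1 : ∀ t → ∣ t * arctan′ t ∣ ≤ 1ℚ
∣t*arctan′∣≤1 t = subst (_≤ 1ℚ)
  (sym (trans (∣p*q∣≡∣p∣*∣q∣ t (arctan′ t)) (cong (∣ t ∣ *_) (∣arctan′∣ t))))
  (≤1+t²⇒ t (∣t∣≤1+t² t))

∣arctan′∣≤1 : ∀ t → ∣ arctan′ t ∣ ≤ 1ℚ
∣arctan′∣≤1 t = subst (_≤ 1ℚ) (sym (∣arctan′∣ t)) (arctan′≤1 t)

∣*∣≤1 : ∀ {p q} → ∣ p ∣ ≤ 1ℚ → ∣ q ∣ ≤ 1ℚ → ∣ p * q ∣ ≤ 1ℚ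
∣*∣≤1 {p} {q} hp hq = subst (_≤ 1ℚ) (sym (∣p*q∣≡∣p∣*∣q∣ p q))
  (*-mono-≤ (0≤∣p∣ p) (nonNegative⁻¹ 1ℚ) hp hq)

2ℚ : ℚ
2ℚ = + 2 / 1

-- Both Lipschitz estimates below divide a polynomial identity by
-- (1+u²)(1+v²); the division is carried out by inserting factors
-- (1+u²)·arctan′ u = 1.
arctan′-lipschitz : ∀ u v → ∣ arctan′ u - arctan′ v ∣ ≤ 2ℚ * ∣ v - u ∣
arctan′-lipschitz u v = subst (_≤ 2ℚ * ∣ v - u ∣)
  (trans (sym (∣p*q∣≡∣p∣*∣q∣ c (v - u))) (cong ∣_∣ (sym eq)))
  (*-monoʳ-≤-nonNeg ∣ v - u ∣ {{∣-∣-nonNeg (v - u)}}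
    (≤-trans (∣p+q∣≤∣p∣+∣q∣ (u * a * b) (v * b * a))
      (+-mono-≤ (∣*∣≤1 (∣t*arctan′∣≤1 u) (∣arctan′∣≤1 v)) (∣*∣≤1 (∣t*arctan′∣≤1 v) (∣arctan′∣≤1 u)))))
  where
  a = arctan′ u
  b = arctan′ v
  c = u * a * b + v * b * a
  eq : a - b ≡ c * (v - u)
  eq = trans
    (sym (cong₂ _-_ (trans (cong (a *_) (arctan′-inverse v)) (*-identityʳ a))
                    (trans (cong (b *_) (arctan′-inverse u)) (*-identityʳ b))))
    (solve 4 (λ u v a b →
        a :* ((con 1ℚ :+ v :* v) :* b) :- b :* ((con 1ℚ :+ u :* u) :* a) :=
        (u :* a :* b :+ v :* b :* a) :* (v :- u)) refl u v a b)

term-lipschitz : ∀ i h k → ∣ h * arctan′ (i * h) - k * arctan′ (i * k) ∣ ≤ 2ℚ * ∣ h - k ∣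
term-lipschitz i h k = subst (_≤ 2ℚ * ∣ h - k ∣)
  (trans (sym (∣p*q∣≡∣p∣*∣q∣ c (h - k))) (cong ∣_∣ (sym eq)))
  (*-monoʳ-≤-nonNeg ∣ h - k ∣ {{∣-∣-nonNeg (h - k)}}
    (≤-trans (∣p-q∣≤∣p∣+∣q∣ (a * b) ((i * h * a) * (i * k * b)))
      (+-mono-≤ (∣*∣≤1 (∣arctan′∣≤1 (i * h)) (∣arctan′∣≤1 (i * k)))
                (∣*∣≤1 (∣t*arctan′∣≤1 (i * h)) (∣t*arctan′∣≤1 (i * k))))))
  where
  a = arctan′ (i * h)
  b = arctan′ (i * k)
  c = a * b - (i * h * a) * (i * k * b)
  eq : h * a - k * b ≡ c * (h - k)
  eq = trans
    (sym (cong₂ _-_ (trans (cong (h * a *_) (arctan′-inverse (i * k))) (*-identityʳ (h * a)))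
                    (trans (cong (k * b *_) (arctan′-inverse (i * h))) (*-identityʳ (k * b)))))
    (solve 5 (λ i h k a b →
        h :* a :* ((con 1ℚ :+ (i :* k) :* (i :* k)) :* b) :-
        k :* b :* ((con 1ℚ :+ (i :* h) :* (i :* h)) :* a) :=
        (a :* b :- (i :* h :* a) :* (i :* k :* b)) :* (h :- k)) refl i h k a b)

arctan-approx-lipschitz : ∀ n p q → ∣ arctan-approx n p - arctan-approx n q ∣ ≤ 2ℚ * ∣ p - q ∣
arctan-approx-lipschitz n p q = subst (∣ arctan-approx n p - arctan-approx n q ∣ ≤_) eq
  (Σ-diff (suc n) (λ i _ → term-lipschitz (fromℕ i) (p * r) (q * r)))
  where
  r = recip n
  eq : fromℕ (suc n) * (2ℚ * ∣ p * r - q * r ∣) ≡ 2ℚ * ∣ p - q ∣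
  eq = trans (cong (λ d → fromℕ (suc n) * (2ℚ * d))
      (trans (cong ∣_∣ (solve 3 (λ p q r → p :* r :- q :* r := (p :- q) :* r) refl p q r))
        (trans (∣p*q∣≡∣p∣*∣q∣ (p - q) r) (cong (∣ p - q ∣ *_) (0≤p⇒∣p∣≡p (<⇒≤ (0<recip n)))))))
    (trans (solve 4 (λ N t d r → N :* (t :* (d :* r)) := (N :* r) :* (t :* d)) refl
             (fromℕ (suc n)) 2ℚ ∣ p - q ∣ r)
      (trans (cong (_* (2ℚ * ∣ p - q ∣)) (fromℕ*recip n)) (*-identityˡ _)))

riemann-refine : ∀ N M h → ∣ riemann N (fromℕ M * h) - riemann (N ℕ.* M) h ∣ ≤
                 fromℕ N * (fromℕ M * (∣ h ∣ * (2ℚ * (fromℕ M * ∣ h ∣))))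
riemann-refine N M h =
  subst (λ s → ∣ riemann N (fromℕ M * h) - s ∣ ≤ fromℕ N * (fromℕ M * block-bound))
    (sym (Σ-blocks N M (λ i → h * arctan′ (fromℕ i * h))))
    (Σ-diff N λ i _ → subst (λ s → ∣ s - Σ[ j < M ] (h * arctan′ (fromℕ (i ℕ.* M ℕ.+ j) * h)) ∣ ≤ fromℕ M * block-bound)
      (trans (Σ-const M (h * arctan′ (fromℕ i * (fromℕ M * h)))) (sym (*-assoc (fromℕ M) h _)))
      (Σ-diff M (λ j j<M → block i j j<M)))
  where
  block-bound = ∣ h ∣ * (2ℚ * (fromℕ M * ∣ h ∣))
  block : ∀ i j → j ℕ.< M →
          ∣ h * arctan′ (fromℕ i * (fromℕ M * h)) - h * arctan′ (fromℕ (i ℕ.* M ℕ.+ j) * h) ∣ ≤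
          ∣ h ∣ * (2ℚ * (fromℕ M * ∣ h ∣))
  block i j j<M = subst (_≤ ∣ h ∣ * (2ℚ * (fromℕ M * ∣ h ∣)))
    (trans (sym (∣p*q∣≡∣p∣*∣q∣ h _))
      (cong ∣_∣ (solve 3 (λ h a b → h :* (a :- b) := h :* a :- h :* b) refl h (arctan′ u) (arctan′ v))))
    (*-monoˡ-≤-nonNeg ∣ h ∣ {{∣-∣-nonNeg h}}
      (≤-trans (arctan′-lipschitz u v)
        (*-monoˡ-≤-nonNeg 2ℚ (subst (_≤ fromℕ M * ∣ h ∣) (sym dist)
          (*-monoʳ-≤-nonNeg ∣ h ∣ {{∣-∣-nonNeg h}} (fromℕ-mono-≤ (ℕₚ.<⇒≤ j<M)))))))
    where
    u = fromℕ i * (fromℕ M * h)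
    v = fromℕ (i ℕ.* M ℕ.+ j) * h
    dist : ∣ v - u ∣ ≡ fromℕ j * ∣ h ∣
    dist = trans (cong ∣_∣ (trans
        (cong (λ w → w * h - u) (trans (fromℕ-+ (i ℕ.* M) j) (cong (_+ fromℕ j) (fromℕ-* i M))))
        (solve 4 (λ i M j h → (i :* M :+ j) :* h :- i :* (M :* h) := j :* h) refl
          (fromℕ i) (fromℕ M) (fromℕ j) h)))
      (trans (∣p*q∣≡∣p∣*∣q∣ (fromℕ j) h) (cong (_* ∣ h ∣) (0≤p⇒∣p∣≡p (0≤fromℕ j))))

arctan-approx-refine : ∀ m n q →
  ∣ arctan-approx m q - riemann (suc m ℕ.* suc n) (q * recip m * recip n) ∣ ≤
  2ℚ * (∣ q ∣ * ∣ q ∣) * recip m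
arctan-approx-refine m n q = subst₂ (λ s b → ∣ s - riemann (suc m ℕ.* suc n) h ∣ ≤ b)
  (cong (riemann (suc m)) (trans
    (solve 3 (λ N p r → N :* (p :* r) := (N :* r) :* p) refl (fromℕ (suc n)) (q * recip m) (recip n))
    (trans (cong (_* (q * recip m)) (fromℕ*recip n)) (*-identityˡ (q * recip m)))))
  bound
  (riemann-refine (suc m) (suc n) h)
  where
  h = q * recip m * recip n
  M = fromℕ (suc m)
  N = fromℕ (suc n)
  a = ∣ q ∣
  r = recip m
  s = recip n
  ∣h∣ : ∣ h ∣ ≡ a * r * s
  ∣h∣ = trans (∣p*q∣≡∣p∣*∣q∣ (q * r) s)
    (cong₂ _*_ (trans (∣p*q∣≡∣p∣*∣q∣ q r) (cong (a *_) (0≤p⇒∣p∣≡p (<⇒≤ (0<recip m)))))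
               (0≤p⇒∣p∣≡p (<⇒≤ (0<recip n))))
  bound : M * (N * (∣ h ∣ * (2ℚ * (N * ∣ h ∣)))) ≡ 2ℚ * (a * a) * r
  bound = trans (cong (λ d → M * (N * (d * (2ℚ * (N * d))))) ∣h∣)
    (trans (solve 6 (λ M N a r s t →
              M :* (N :* ((a :* r :* s) :* (t :* (N :* (a :* r :* s))))) :=
              (M :* r) :* ((N :* s) :* ((N :* s) :* (t :* (a :* a) :* r)))) refl M N a r s 2ℚ)
      (trans (cong₂ (λ x y → x * (y * (y * (2ℚ * (a * a) * r)))) (fromℕ*recip m) (fromℕ*recip n))
        (trans (*-identityˡ _) (trans (*-identityˡ _) (*-identityˡ _)))))

arctan-approx-diff : ∀ m n q → ∣ arctan-approx m q - arctan-approx n q ∣ ≤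
                     2ℚ * (∣ q ∣ * ∣ q ∣) * recip m + 2ℚ * (∣ q ∣ * ∣ q ∣) * recip n
arctan-approx-diff m n q = ≤-trans
  (∣-∣-triangle (arctan-approx m q) common (arctan-approx n q))
  (+-mono-≤ (arctan-approx-refine m n q)
    (subst (_≤ 2ℚ * (∣ q ∣ * ∣ q ∣) * recip n)
      (trans (cong (λ s → ∣ arctan-approx n q - s ∣) same) (∣-∣-comm (arctan-approx n q) common))
      (arctan-approx-refine n m q)))
  where
  common = riemann (suc m ℕ.* suc n) (q * recip m * recip n)
  same : riemann (suc n ℕ.* suc m) (q * recip n * recip m) ≡ common
  same = cong₂ riemann (ℕₚ.*-comm (suc n) (suc m))
    (solve 3 (λ q r s → q :* s :* r := q :* r :* s) refl q (recip m) (recip n))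

-- ∫₀ˣ dt/(1+t²): the n-th approximation is the Riemann sum with n+1 steps
-- over the interval from 0 to the n-th approximation of x.
arctan : ℝ → ℝ
arctan x = mkℝ (λ n → arctan-approx n (seq x n)) (arctan-cauchy (eventually-bounded x))
  where
  arctan-cauchy : EventuallyBounded x → ∀ ε → 0ℚ < ε → ∃ λ N → ∀ m n → N ℕ.≤ m → N ℕ.≤ n →
                  ∣ arctan-approx m (seq x m) - arctan-approx n (seq x n) ∣ < ε
  arctan-cauchy (B , 0<B , N₁ , hB) ε 0<ε = N , bound
    where
    C = 2ℚ * (B * B)
    0≤C : 0ℚ ≤ C
    0≤C = 0≤-* (nonNegative⁻¹ 2ℚ) (0≤-* (<⇒≤ 0<B) (<⇒≤ 0<B))
    η = ½ * ε
    0<η : 0ℚ < η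
    0<η = 0<½ 0<ε
    cx = cauchy x (½ * η) (0<½ 0<η)
    small = recip-eventually-< C 0≤C (0<½ 0<η)
    N = N₁ ℕ.⊔ (proj₁ cx ℕ.⊔ proj₁ small)
    bound : ∀ m n → N ℕ.≤ m → N ℕ.≤ n →
            ∣ arctan-approx m (seq x m) - arctan-approx n (seq x n) ∣ < ε
    bound m n N≤m N≤n = ≤-<-trans
      (∣-∣-triangle (arctan-approx m p) (arctan-approx m q) (arctan-approx n q))
      (subst (∣ arctan-approx m p - arctan-approx m q ∣ + ∣ arctan-approx m q - arctan-approx n q ∣ <_)
        (½+½ ε) (+-mono-< first second))
      where
      p = seq x m
      q = seq x n
      to₂ : ∀ {k} → N ℕ.≤ k → proj₁ cx ℕ.≤ k
      to₂ le = ℕₚ.m⊔n≤o⇒m≤o (proj₁ cx) (proj₁ small) (ℕₚ.m⊔n≤o⇒n≤o N₁ _ le)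
      to₃ : ∀ {k} → N ℕ.≤ k → proj₁ small ℕ.≤ k
      to₃ le = ℕₚ.m⊔n≤o⇒n≤o (proj₁ cx) (proj₁ small) (ℕₚ.m⊔n≤o⇒n≤o N₁ _ le)
      ∣q∣≤B : ∣ q ∣ ≤ B
      ∣q∣≤B = hB n (ℕₚ.m⊔n≤o⇒m≤o N₁ _ N≤n)
      ∣q∣²≤ : 2ℚ * (∣ q ∣ * ∣ q ∣) ≤ C
      ∣q∣²≤ = *-monoˡ-≤-nonNeg 2ℚ (*-mono-≤ (0≤∣p∣ q) (<⇒≤ 0<B) ∣q∣≤B ∣q∣≤B)
      first : ∣ arctan-approx m p - arctan-approx m q ∣ < η
      first = ≤-<-trans (arctan-approx-lipschitz m p q)
        (subst (2ℚ * ∣ p - q ∣ <_)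
          (trans (sym (*-assoc 2ℚ ½ η)) (*-identityˡ η))
          (*-monoʳ-<-pos 2ℚ (proj₂ cx m n (to₂ N≤m) (to₂ N≤n))))
      part : ∀ k → N ℕ.≤ k → 2ℚ * (∣ q ∣ * ∣ q ∣) * recip k < ½ * η
      part k le = ≤-<-trans (*-monoʳ-≤-nonNeg (recip k) {{nonNegative (<⇒≤ (0<recip k))}} ∣q∣²≤)
        (proj₂ small k (to₃ le))
      second : ∣ arctan-approx m q - arctan-approx n q ∣ < η
      second = ≤-<-trans (arctan-approx-diff m n q)
        (subst (2ℚ * (∣ q ∣ * ∣ q ∣) * recip m + 2ℚ * (∣ q ∣ * ∣ q ∣) * recip n <_) (½+½ η)
          (+-mono-< (part m N≤m) (part n N≤n)))

-- In the parametrisation described at arctan′, the arc from slope -1 to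
-- slope 1 is a quarter of the unit circle (the vectors (1,-1) and (1,1) are
-- orthogonal); its length, half of π, is ∫₋₁¹ dt/(1+t²) = 2 arctan 1.
π : ℝ
π = fromℚ (+ 4 / 1) *ᵣ arctan (fromℚ 1ℚ)

module Submission where

-- Put G(z) = arctan (½ (z - 1/z)) + 2 arctan (1/z) for z ≥ 1. Its derivative
-- vanishes; in rational terms, |G(z′) - G(z)| ≤ 7 (z′ - z)² up to a
-- discretisation error O(1/m) at the m-th approximation. Cutting [1, z] into
-- N + 1 equal steps gives |G(z) - G(1)| = O(1/N) + O(N/m), so letting first m
-- and then N grow yields G(z) = G(1) = 2 arctan 1 = π/2. For odd n and
-- z = φⁿ, Binet's formula gives z - 1/z = Lₙ. The rational approximations x
-- of φ satisfy it only up to a multiple of x² - x - 1, which is O(1/m).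

open import Defs

module ArctangentLucas where

  open import Algebra.Bundles using (CommutativeRing)
  open import Data.Nat.Base as ℕ using (ℕ; zero; suc)
  import Data.Nat.Properties as ℕₚ
  import Data.Integer.Base as ℤ
  import Data.Integer.Properties as ℤₚ
  open import Data.Rational.Base
  open import Data.Rational.Properties
  open import Data.Rational.Solver using (module +-*-Solver)
  open import Data.Product.Base using (∃; ∃₂; _×_; _,_; proj₁; proj₂)
  open import Relation.Binary.PropositionalEquality
  open import Algebra.Properties.CommutativeSemiring.Exp
    (CommutativeRing.commutativeSemiring +-*-commutativeRing)
    using (_^_; ^-distrib-*; ^-assocʳ; ^-homo-*)
  open +-*-Solver using (solve; _:=_; _:+_; _:*_; _:-_; :-_; con)
  open ≤-Reasoning

  -- Rational inequalities and common denominators.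

  0≤q-p : ∀ {p q} → p ≤ q → 0ℚ ≤ q - p
  0≤q-p {p} {q} p≤q = subst (_≤ q - p) (+-inverseʳ p) (+-monoˡ-≤ (- p) p≤q)

  p+[q-p] : ∀ p q → p + (q - p) ≡ q
  p+[q-p] = solve 2 (λ p q → p :+ (q :- p) := q) refl

  ∣-∣-≤-width : ∀ {p q s t} → p ≤ s → s ≤ q → p ≤ t → t ≤ q → ∣ s - t ∣ ≤ q - p
  ∣-∣-≤-width {p} {q} {s} {t} p≤s s≤q p≤t t≤q = ∣∣-≤
    (+-mono-≤ s≤q (neg-antimono-≤ p≤t))
    (subst (_≤ q - p) (solve 2 (λ s t → t :- s := :- (s :- t)) refl s t)
      (+-mono-≤ t≤q (neg-antimono-≤ p≤s)))

  ∣p*q∣-nonNegʳ : ∀ p {q} → 0ℚ ≤ q → ∣ p * q ∣ ≡ ∣ p ∣ * q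
  ∣p*q∣-nonNegʳ p {q} 0≤q = trans (∣p*q∣≡∣p∣*∣q∣ p q) (cong (∣ p ∣ *_) (0≤p⇒∣p∣≡p 0≤q))

  *-cancel-inverse : ∀ p q r → p * q ≡ 1ℚ → p * q * r ≡ r
  *-cancel-inverse p q r pq≡1 = trans (cong (_* r) pq≡1) (*-identityˡ r)

  ∣-∣-replace : ∀ a b c d x {α β γ} → ∣ a - c ∣ ≤ α → ∣ b - d ∣ ≤ β → ∣ (c - d) - x ∣ ≤ γ →
                ∣ (a - b) - x ∣ ≤ γ + (α + β)
  ∣-∣-replace a b c d x {α} {β} {γ} a≈c b≈d c-d≈x = begin
    ∣ (a - b) - x ∣
      ≡⟨ cong ∣_∣ (solve 5 (λ a b c d x → (a :- b) :- x :=
           ((c :- d) :- x) :+ ((a :- c) :- (b :- d))) refl a b c d x) ⟩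
    ∣ ((c - d) - x) + ((a - c) - (b - d)) ∣
      ≤⟨ ∣p+q∣≤∣p∣+∣q∣ ((c - d) - x) ((a - c) - (b - d)) ⟩
    ∣ (c - d) - x ∣ + ∣ (a - c) - (b - d) ∣
      ≤⟨ +-mono-≤ c-d≈x (≤-trans (∣p-q∣≤∣p∣+∣q∣ (a - c) (b - d)) (+-mono-≤ a≈c b≈d)) ⟩
    γ + (α + β) ∎

  nonNeg-fraction : ∀ {p} → 0ℚ ≤ p → ∃₂ λ a b → p ≡ fromℕ a * recip b
  nonNeg-fraction {mkℚ (ℤ.+ a) b c} _ = a , b ,
    trans (sym (normalize-coprime c))
      -- `fromℕ a * recip b` unfolds to a·1 over 1·(b+1), not to a over b+1.
      (sym (/-cong (ℤₚ.*-identityʳ (ℤ.+ a)) (ℕₚ.*-identityˡ (suc b))))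
  nonNeg-fraction {mkℚ ℤ.-[1+ _ ] _ _} (*≤* ())

  -- Over a common denominator both numbers are multiples of one step `h`. This puts the endpoints
  -- of two Riemann sums on the same grid, where the sums can be subtracted term by term.
  commensurable : ∀ {p q} → 0ℚ ≤ p → 0ℚ ≤ q →
                  ∃ λ h → 0ℚ ≤ h × ∃₂ λ a b → p ≡ fromℕ a * h × q ≡ fromℕ b * h
  commensurable {p} {q} 0≤p 0≤q with nonNeg-fraction 0≤p | nonNeg-fraction 0≤q
  ... | a , b , p≡ | c , d , q≡ =
    recip b * recip d , 0≤-* (<⇒≤ (0<recip b)) (<⇒≤ (0<recip d)) ,
    a ℕ.* suc d , c ℕ.* suc b ,
    trans p≡ (sym (trans (cong (_* (recip b * recip d)) (fromℕ-* a (suc d)))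
      (trans (solve 4 (λ a D r s → a :* D :* (r :* s) := D :* s :* (a :* r)) refl
               (fromℕ a) (fromℕ (suc d)) (recip b) (recip d))
        (*-cancel-inverse (fromℕ (suc d)) (recip d) _ (fromℕ*recip d))))) ,
    trans q≡ (sym (trans (cong (_* (recip b * recip d)) (fromℕ-* c (suc b)))
      (trans (solve 4 (λ c B r s → c :* B :* (r :* s) := B :* r :* (c :* s)) refl
               (fromℕ c) (fromℕ (suc b)) (recip b) (recip d))
        (*-cancel-inverse (fromℕ (suc b)) (recip b) _ (fromℕ*recip b)))))

  -- First-order expansion of the Riemann sums for arctan.

  fromℕ-rescale : ∀ n u h → fromℕ (suc n ℕ.* u) * (h * recip n) ≡ fromℕ u * h
  fromℕ-rescale n u h = trans (cong (_* (h * recip n)) (fromℕ-* (suc n) u))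
    (trans (solve 4 (λ N u h r → N :* u :* (h :* r) := N :* r :* (u :* h)) refl
             (fromℕ (suc n)) (fromℕ u) h (recip n))
      (*-cancel-inverse (fromℕ (suc n)) (recip n) _ (fromℕ*recip n)))

  -- Splitting each of the n+1 steps up to `p` into `u` pieces gives steps of length h/(n+1), which
  -- no longer depend on `p`. Approximations at different grid points thereby become, up to the
  -- stated error, initial segments of one and the same series.
  arctan-approx-grid : ∀ n u h → let p = fromℕ u * h in
    ∣ arctan-approx n p - riemann (suc n ℕ.* u) (h * recip n) ∣ ≤ 2ℚ * (p * p) * recip n
  arctan-approx-grid n u h =
    subst₂ (λ x b → ∣ riemann (suc n) x - riemann (suc n ℕ.* u) (h * r) ∣ ≤ b)
      (sym (*-assoc U h r)) bound (riemann-refine (suc n) u (h * r))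
    where
    U = fromℕ u
    N = fromℕ (suc n)
    r = recip n
    bound : N * (U * (∣ h * r ∣ * (2ℚ * (U * ∣ h * r ∣)))) ≡ 2ℚ * (U * h * (U * h)) * r
    bound = begin-equality
      N * (U * (∣ h * r ∣ * (2ℚ * (U * ∣ h * r ∣))))
        ≡⟨ cong (λ x → N * (U * (x * (2ℚ * (U * x))))) (∣p*q∣-nonNegʳ h (<⇒≤ (0<recip n))) ⟩
      N * (U * (∣ h ∣ * r * (2ℚ * (U * (∣ h ∣ * r)))))
        ≡⟨ solve 5 (λ N U a r t → N :* (U :* (a :* r :* (t :* (U :* (a :* r))))) :=
                     N :* r :* (t :* (U :* U :* (a :* a)) :* r)) refl N U ∣ h ∣ r 2ℚ ⟩
      N * r * (2ℚ * (U * U * (∣ h ∣ * ∣ h ∣)) * r)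
        ≡⟨ *-cancel-inverse N r _ (fromℕ*recip n) ⟩
      2ℚ * (U * U * (∣ h ∣ * ∣ h ∣)) * r
        ≡⟨ cong (λ x → 2ℚ * (U * U * x) * r) (∣∣-square h) ⟩
      2ℚ * (U * U * (h * h)) * r
        ≡⟨ solve 4 (λ U h r t → t :* (U :* U :* (h :* h)) :* r := t :* (U :* h :* (U :* h)) :* r)
             refl U h r 2ℚ ⟩
      2ℚ * (U * h * (U * h)) * r ∎

  -- The two sums differ by the block of terms m, ..., m+d-1, and `arctan′-lipschitz` moves every
  -- sample point of that block to the single point `t`.
  riemann-increment : ∀ m d h t {b} →
    (∀ j → j ℕ.< d → ∣ t - fromℕ (m ℕ.+ j) * h ∣ ≤ b) →
    ∣ (riemann (m ℕ.+ d) h - riemann m h) - fromℕ d * h * arctan′ t ∣ ≤ fromℕ d * (∣ h ∣ * (2ℚ * b))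
  riemann-increment m d h t {b} near =
    subst₂ (λ x y → ∣ x - y ∣ ≤ fromℕ d * (∣ h ∣ * (2ℚ * b)))
      (sym (trans (cong (_- riemann m h) (Σ-split m d _))
        (solve 2 (λ s t → s :+ t :- s := t) refl (riemann m h) _)))
      (trans (Σ-const d (h * arctan′ t)) (sym (*-assoc (fromℕ d) h _)))
      (Σ-diff d term)
    where
    term : ∀ j → j ℕ.< d →
      ∣ h * arctan′ (fromℕ (m ℕ.+ j) * h) - h * arctan′ t ∣ ≤ ∣ h ∣ * (2ℚ * b)
    term j j<d = begin
      ∣ h * a - h * arctan′ t ∣  ≡⟨ cong ∣_∣ (solve 3 (λ h a b → h :* a :- h :* b := h :* (a :- b)) refl h a (arctan′ t)) ⟩
      ∣ h * (a - arctan′ t) ∣    ≡⟨ ∣p*q∣≡∣p∣*∣q∣ h (a - arctan′ t) ⟩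
      ∣ h ∣ * ∣ a - arctan′ t ∣  ≤⟨ *-monoˡ-≤-nonNeg ∣ h ∣ {{∣-∣-nonNeg h}}
                                      (≤-trans (arctan′-lipschitz v t) (*-monoˡ-≤-nonNeg 2ℚ (near j j<d))) ⟩
      ∣ h ∣ * (2ℚ * b)           ∎
      where
      v = fromℕ (m ℕ.+ j) * h
      a = arctan′ v

  -- First-order expansion of arctan, with a quadratic remainder; the terms
  -- containing recip n are the discretisation errors at q and p.
  arctan-approx-increment : ∀ n {p q t} → 0ℚ ≤ p → p ≤ t → t ≤ q →
    ∣ (arctan-approx n q - arctan-approx n p) - (q - p) * arctan′ t ∣ ≤
    2ℚ * ((q - p) * (q - p)) + (2ℚ * (q * q) * recip n + 2ℚ * (p * p) * recip n)
  arctan-approx-increment n {p} {q} {t} 0≤p p≤t t≤q = on-grid (commensurable 0≤p 0≤e)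
    where
    F = arctan-approx n
    e = q - p
    0≤e = 0≤q-p (≤-trans p≤t t≤q)
    module OnGrid (h : ℚ) (0≤h : 0ℚ ≤ h) (u d : ℕ) (p≡ : p ≡ fromℕ u * h) (e≡ : e ≡ fromℕ d * h) where
      h′ = h * recip n
      0≤h′ : 0ℚ ≤ h′
      0≤h′ = 0≤-* 0≤h (<⇒≤ (0<recip n))
      -- The left Riemann sum over [0, v·h] with step `h′`; `S (u + d) - S u` is then the part of
      -- the sum lying between `p` and `q`.
      S : ℕ → ℚ
      S v = riemann (suc n ℕ.* v) h′
      q≡ : q ≡ fromℕ (u ℕ.+ d) * h
      q≡ = trans (sym (p+[q-p] p q)) (trans (cong₂ _+_ p≡ e≡)
        (trans (sym (*-distribʳ-+ h (fromℕ u) (fromℕ d))) (cong (_* h) (sym (fromℕ-+ u d)))))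
      grid : ∀ x v → x ≡ fromℕ v * h → ∣ F x - S v ∣ ≤ 2ℚ * (x * x) * recip n
      grid x v refl = arctan-approx-grid n v h
      at : ∀ {x} v → x ≡ fromℕ v * h → fromℕ (suc n ℕ.* v) * h′ ≡ x
      at v x≡ = trans (fromℕ-rescale n v h) (sym x≡)
      split : suc n ℕ.* (u ℕ.+ d) ≡ suc n ℕ.* u ℕ.+ suc n ℕ.* d
      split = ℕₚ.*-distribˡ-+ (suc n) u d
      grid-mono : ∀ {i j} → i ℕ.≤ j → fromℕ i * h′ ≤ fromℕ j * h′
      grid-mono i≤j = *-monoʳ-≤-nonNeg h′ {{nonNegative 0≤h′}} (fromℕ-mono-≤ i≤j)
      -- All sample points of the block lie in [p, q], as does `t`, so the width `e` bounds their
      -- distance from `t`.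
      near : ∀ j → j ℕ.< suc n ℕ.* d → ∣ t - fromℕ (suc n ℕ.* u ℕ.+ j) * h′ ∣ ≤ e
      near j j< = ∣-∣-≤-width p≤t t≤q
        (subst (_≤ fromℕ (suc n ℕ.* u ℕ.+ j) * h′) (at u p≡) (grid-mono (ℕₚ.m≤m+n _ j)))
        (subst (fromℕ (suc n ℕ.* u ℕ.+ j) * h′ ≤_)
          (trans (cong (λ k → fromℕ k * h′) (sym split)) (at (u ℕ.+ d) q≡))
          (grid-mono (ℕₚ.+-monoʳ-≤ (suc n ℕ.* u) (ℕₚ.<⇒≤ j<))))
      -- Each term of the block is off by at most h′·2e, and the block's steps `h′` add up to `e`.
      error : fromℕ (suc n ℕ.* d) * (∣ h′ ∣ * (2ℚ * e)) ≡ 2ℚ * (e * e)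
      error = begin-equality
        fromℕ (suc n ℕ.* d) * (∣ h′ ∣ * (2ℚ * e)) ≡⟨ cong (λ x → fromℕ (suc n ℕ.* d) * (x * (2ℚ * e))) (0≤p⇒∣p∣≡p 0≤h′) ⟩
        fromℕ (suc n ℕ.* d) * (h′ * (2ℚ * e))     ≡⟨ *-assoc (fromℕ (suc n ℕ.* d)) h′ _ ⟨
        fromℕ (suc n ℕ.* d) * h′ * (2ℚ * e)       ≡⟨ cong (_* (2ℚ * e)) (at d e≡) ⟩
        e * (2ℚ * e)                              ≡⟨ solve 2 (λ e t → e :* (t :* e) := t :* (e :* e)) refl e 2ℚ ⟩
        2ℚ * (e * e)                              ∎
      increment : ∣ (S (u ℕ.+ d) - S u) - e * arctan′ t ∣ ≤ 2ℚ * (e * e)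
      increment = subst₂ _≤_
        (cong₂ (λ k x → ∣ (riemann k h′ - S u) - x * arctan′ t ∣) (sym split) (at d e≡))
        error
        (riemann-increment (suc n ℕ.* u) (suc n ℕ.* d) h′ t near)
    on-grid : (∃ λ h → 0ℚ ≤ h × ∃₂ λ u d → p ≡ fromℕ u * h × e ≡ fromℕ d * h) →
      ∣ (F q - F p) - e * arctan′ t ∣ ≤ 2ℚ * (e * e) + (2ℚ * (q * q) * recip n + 2ℚ * (p * p) * recip n)
    on-grid (h , 0≤h , u , d , p≡ , e≡) =
      ∣-∣-replace (F q) (F p) (S (u ℕ.+ d)) (S u) (e * arctan′ t)
        (grid q (u ℕ.+ d) q≡) (grid p u p≡) increment
      where open OnGrid h 0≤h u d p≡ e≡

  -- The doubled angle and the cancellation of the derivatives.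

  inverse-unique : ∀ p q r → p * q ≡ 1ℚ → p * r ≡ 1ℚ → q ≡ r
  inverse-unique p q r pq≡1 pr≡1 = begin-equality
    q            ≡⟨ *-identityˡ q ⟨
    1ℚ * q       ≡⟨ cong (_* q) pr≡1 ⟨
    p * r * q    ≡⟨ solve 3 (λ p q r → p :* r :* q := p :* q :* r) refl p q r ⟩
    p * q * r    ≡⟨ *-cancel-inverse p q r pq≡1 ⟩
    r            ∎

  square-mono-≤ : ∀ {p q} → 0ℚ ≤ p → p ≤ q → p * p ≤ q * q
  square-mono-≤ 0≤p p≤q = *-mono-≤ 0≤p (≤-trans 0≤p p≤q) p≤q p≤q

  inverse-difference : ∀ z w z′ w′ → z * w ≡ 1ℚ → z′ * w′ ≡ 1ℚ → w - w′ ≡ w * w′ * (z′ - z)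
  inverse-difference z w z′ w′ zw≡1 z′w′≡1 = begin-equality
    w - w′                        ≡⟨ cong₂ _-_ (*-cancel-inverse z′ w′ w z′w′≡1) (*-cancel-inverse z w w′ zw≡1) ⟨
    z′ * w′ * w - z * w * w′      ≡⟨ solve 4 (λ z w z′ w′ → z′ :* w′ :* w :- z :* w :* w′ := w :* w′ :* (z′ :- z)) refl z w z′ w′ ⟩
    w * w′ * (z′ - z)             ∎

  -- With z = cot α and w = 1/z = tan α, ½ (z - w) is cot 2α.
  cot2 : ℚ → ℚ → ℚ
  cot2 z w = ½ * (z - w)

  -- Since zw = 1, 1 + (½(z - w))² = (½(z + w))² and 1 + w² = w(z + w), so both sides equal z/(z +
  -- w). Reciprocals enter only through their defining equations, which leaves polynomial identities
  -- for the ring solver.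
  arctan′-tangent : ∀ z w a b → z * w ≡ 1ℚ →
    (1ℚ + cot2 z w * cot2 z w) * a ≡ 1ℚ → (1ℚ + w * w) * b ≡ 1ℚ →
    b ≡ ½ * ½ * z * (z + w) * a
  arctan′-tangent z w a b zw≡1 ga≡1 wb≡1 = inverse-unique (1ℚ + w * w) b _ wb≡1 (begin-equality
    (1ℚ + w * w) * (½ * ½ * z * (z + w) * a)
      ≡⟨ cong (λ x → (x + w * w) * (½ * ½ * z * (z + w) * a)) zw≡1 ⟨
    (z * w + w * w) * (½ * ½ * z * (z + w) * a)
      ≡⟨ solve 3 (λ z w a → (z :* w :+ w :* w) :* (con ½ :* con ½ :* z :* (z :+ w) :* a) :=
           z :* w :* ((z :* w :+ con ½ :* (z :- w) :* (con ½ :* (z :- w))) :* a)) refl z w a ⟩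
    z * w * ((z * w + cot2 z w * cot2 z w) * a)
      ≡⟨ *-cancel-inverse z w _ zw≡1 ⟩
    (z * w + cot2 z w * cot2 z w) * a
      ≡⟨ cong (λ x → (x + cot2 z w * cot2 z w) * a) zw≡1 ⟩
    (1ℚ + cot2 z w * cot2 z w) * a
      ≡⟨ ga≡1 ⟩
    1ℚ ∎)

  -- d/dz (arctan (cot2 z (1/z)) + 2 arctan (1/z)) = 0, as an identity of
  -- difference quotients with explicit second-order remainder.
  slope-cancellation : ∀ z w z′ w′ a b → z * w ≡ 1ℚ → z′ * w′ ≡ 1ℚ →
    (1ℚ + cot2 z w * cot2 z w) * a ≡ 1ℚ → (1ℚ + w * w) * b ≡ 1ℚ →
    (cot2 z′ w′ - cot2 z w) * a - 2ℚ * ((w - w′) * b) ≡ ½ * ((z′ - z) * (z′ - z)) * (w′ * a)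
  slope-cancellation z w z′ w′ a b zw≡1 z′w′≡1 ga≡1 wb≡1 = begin-equality
    (cot2 z′ w′ - cot2 z w) * a - 2ℚ * ((w - w′) * b)
      ≡⟨ solve 6 (λ z w z′ w′ a b →
           (con ½ :* (z′ :- w′) :- con ½ :* (z :- w)) :* a :- con 2ℚ :* ((w :- w′) :* b) :=
           con ½ :* ((z′ :- z) :+ (w :- w′)) :* a :- con 2ℚ :* ((w :- w′) :* b)) refl z w z′ w′ a b ⟩
    ½ * ((z′ - z) + (w - w′)) * a - 2ℚ * ((w - w′) * b)
      ≡⟨ cong₂ (λ x y → ½ * ((z′ - z) + x) * a - 2ℚ * (x * y))
           (inverse-difference z w z′ w′ zw≡1 z′w′≡1) (arctan′-tangent z w a b zw≡1 ga≡1 wb≡1) ⟩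
    ½ * (d + w * w′ * d) * a - 2ℚ * (w * w′ * d * (½ * ½ * z * (z + w) * a))
      ≡⟨ solve 5 (λ z w w′ a d →
           con ½ :* (d :+ w :* w′ :* d) :* a :-
           con 2ℚ :* (w :* w′ :* d :* (con ½ :* con ½ :* z :* (z :+ w) :* a)) :=
           con ½ :* d :* a :* (con 1ℚ :+ w :* w′ :- z :* w :* (w′ :* (z :+ w)))) refl z w w′ a d ⟩
    ½ * d * a * (1ℚ + w * w′ - z * w * (w′ * (z + w)))
      -- Writing 1 as z′w′ and cancelling zw turns the bracket into w′(z′ - z), which supplies the
      -- second factor `d`.
      ≡⟨ cong₂ (λ x y → ½ * d * a * (x + w * w′ - y)) (sym z′w′≡1) (*-cancel-inverse z w _ zw≡1) ⟩
    ½ * d * a * (z′ * w′ + w * w′ - w′ * (z + w))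
      ≡⟨ solve 5 (λ z w z′ w′ a →
           con ½ :* (z′ :- z) :* a :* (z′ :* w′ :+ w :* w′ :- w′ :* (z :+ w)) :=
           con ½ :* ((z′ :- z) :* (z′ :- z)) :* (w′ :* a)) refl z w z′ w′ a ⟩
    ½ * (d * d) * (w′ * a) ∎
    where d = z′ - z

  -- Near-constancy of the angle function.

  ½*-≤ : ∀ {p} → 0ℚ ≤ p → ½ * p ≤ p
  ½*-≤ {p} 0≤p = subst₂ _≤_ (+-identityʳ (½ * p)) (½+½ p)
    (+-monoʳ-≤ (½ * p) (0≤-* {½} (nonNegative⁻¹ ½) 0≤p))

  p-q≤p : ∀ {p q} → 0ℚ ≤ q → p - q ≤ p
  p-q≤p {p} {q} 0≤q = subst (p - q ≤_) (+-identityʳ p) (+-monoʳ-≤ p (neg-antimono-≤ 0≤q))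

  0≤cot2 : ∀ {z w} → w ≤ z → 0ℚ ≤ cot2 z w
  0≤cot2 w≤z = 0≤-* (nonNegative⁻¹ ½) (0≤q-p w≤z)

  cot2≤ : ∀ {z w} → 0ℚ ≤ w → w ≤ z → cot2 z w ≤ z
  cot2≤ 0≤w w≤z = ≤-trans (½*-≤ (0≤q-p w≤z)) (p-q≤p 0≤w)

  -- The n-th approximation of G at a rational point, both arctangents being taken with n+1 steps.
  angle : ℕ → ℚ → ℚ
  angle n z = arctan-approx n (cot2 z (inv z)) + 2ℚ * arctan-approx n (inv z)

  ∣p-2q+r∣≤ : ∀ p q r {α β γ} → ∣ p ∣ ≤ α → ∣ q ∣ ≤ β → ∣ r ∣ ≤ γ →
              ∣ (p - 2ℚ * q) + r ∣ ≤ (α + 2ℚ * β) + γ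
  ∣p-2q+r∣≤ p q r {α} {β} {γ} p≤ q≤ r≤ = begin
    ∣ (p - 2ℚ * q) + r ∣           ≤⟨ ∣p+q∣≤∣p∣+∣q∣ (p - 2ℚ * q) r ⟩
    ∣ p - 2ℚ * q ∣ + ∣ r ∣         ≤⟨ +-monoˡ-≤ ∣ r ∣ (∣p-q∣≤∣p∣+∣q∣ p (2ℚ * q)) ⟩
    ∣ p ∣ + ∣ 2ℚ * q ∣ + ∣ r ∣     ≡⟨ cong (λ x → ∣ p ∣ + x + ∣ r ∣) (∣p*q∣≡∣p∣*∣q∣ 2ℚ q) ⟩
    ∣ p ∣ + 2ℚ * ∣ q ∣ + ∣ r ∣     ≤⟨ +-mono-≤ (+-mono-≤ p≤ (*-monoˡ-≤-nonNeg 2ℚ q≤)) r≤ ⟩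
    (α + 2ℚ * β) + γ               ∎

  -- Replaces the separate endpoints and widths by common bounds `B` and `d`, so that a single error
  -- term serves both arctangents in `angle`.
  arctan-approx-increment-uniform : ∀ n {p q t d B} → 0ℚ ≤ p → p ≤ t → t ≤ q → q - p ≤ d → q ≤ B →
    ∣ (arctan-approx n q - arctan-approx n p) - (q - p) * arctan′ t ∣ ≤
    2ℚ * (d * d) + (2ℚ * (B * B) * recip n + 2ℚ * (B * B) * recip n)
  arctan-approx-increment-uniform n {p} {q} {t} {d} {B} 0≤p p≤t t≤q e≤d q≤B =
    ≤-trans (arctan-approx-increment n 0≤p p≤t t≤q)
      (+-mono-≤ (*-monoˡ-≤-nonNeg 2ℚ (square-mono-≤ (0≤q-p p≤q) e≤d))
        (+-mono-≤ (part (≤-trans 0≤p p≤q) q≤B) (part 0≤p (≤-trans p≤q q≤B))))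
    where
    p≤q = ≤-trans p≤t t≤q
    part : ∀ {x} → 0ℚ ≤ x → x ≤ B → 2ℚ * (x * x) * recip n ≤ 2ℚ * (B * B) * recip n
    part 0≤x x≤B = *-monoʳ-≤-nonNeg (recip n) {{nonNegative (<⇒≤ (0<recip n))}}
      (*-monoˡ-≤-nonNeg 2ℚ (square-mono-≤ 0≤x x≤B))

  1≤⇒0< : ∀ {z} → 1ℚ ≤ z → 0ℚ < z
  1≤⇒0< = <-≤-trans (positive⁻¹ 1ℚ)

  inv≤1 : ∀ {z} → 1ℚ ≤ z → inv z ≤ 1ℚ
  inv≤1 = inv-anti-≤ (positive⁻¹ 1ℚ)

  -- Both arctangents are expanded to first order at the points belonging to `z`; the linear terms
  -- cancel by `slope-cancellation` up to d². With expansion error E = 2d² + 4B²/(n+1), the total E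
  -- + 2E + d² gives the constants 7 and 12.
  angle-step : ∀ n {z z′ B} → 1ℚ ≤ z → z ≤ z′ → z′ ≤ B →
    ∣ angle n z′ - angle n z ∣ ≤
    fromℕ 7 * ((z′ - z) * (z′ - z)) + fromℕ 12 * (B * B) * recip n
  angle-step n {z} {z′} {B} 1≤z z≤z′ z′≤B = begin
    ∣ angle n z′ - angle n z ∣
      ≡⟨ cong ∣_∣ (solve 6 (λ Fg′ Fw′ Fg Fw x y →
           (Fg′ :+ con 2ℚ :* Fw′) :- (Fg :+ con 2ℚ :* Fw) :=
           (((Fg′ :- Fg) :- x) :- con 2ℚ :* ((Fw :- Fw′) :- y)) :+ (x :- con 2ℚ :* y))
           refl (F g′) (F w′) (F g) (F w) ((g′ - g) * arctan′ g) ((w - w′) * arctan′ w)) ⟩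
    ∣ (((F g′ - F g) - (g′ - g) * arctan′ g) - 2ℚ * ((F w - F w′) - (w - w′) * arctan′ w)) +
      ((g′ - g) * arctan′ g - 2ℚ * ((w - w′) * arctan′ w)) ∣
      ≤⟨ ∣p-2q+r∣≤ ((F g′ - F g) - (g′ - g) * arctan′ g) ((F w - F w′) - (w - w′) * arctan′ w)
           ((g′ - g) * arctan′ g - 2ℚ * ((w - w′) * arctan′ w))
           -- As z grows, cot2 increases while 1/z decreases. The derivative is therefore taken at
           -- the left endpoint `g` of [g, g′], but at the right endpoint `w` of [w′, w].
           (arctan-approx-increment-uniform n (0≤cot2 w≤z) ≤-refl g≤g′ Δg≤d (≤-trans (cot2≤ 0≤w′ w′≤z′) z′≤B))
           (arctan-approx-increment-uniform n 0≤w′ w′≤w ≤-refl Δw≤d (≤-trans w≤z (≤-trans z≤z′ z′≤B)))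
           remainder ⟩
    (E + 2ℚ * E) + d * d
      ≡⟨ solve 3 (λ d B r →
           let E = con 2ℚ :* (d :* d) :+ (con 2ℚ :* (B :* B) :* r :+ con 2ℚ :* (B :* B) :* r) in
           (E :+ con 2ℚ :* E) :+ d :* d := con (fromℕ 7) :* (d :* d) :+ con (fromℕ 12) :* (B :* B) :* r)
           refl d B (recip n) ⟩
    fromℕ 7 * (d * d) + fromℕ 12 * (B * B) * recip n ∎
    where
    F = arctan-approx n
    w = inv z
    w′ = inv z′
    g = cot2 z w
    g′ = cot2 z′ w′
    d = z′ - z
    E = 2ℚ * (d * d) + (2ℚ * (B * B) * recip n + 2ℚ * (B * B) * recip n)
    1≤z′ = ≤-trans 1≤z z≤z′
    zw≡1 = inv-inverseʳ (1≤⇒0< 1≤z)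
    z′w′≡1 = inv-inverseʳ (1≤⇒0< 1≤z′)
    w≤1 = inv≤1 1≤z
    w′≤1 = inv≤1 1≤z′
    0≤w = <⇒≤ (inv-pos (1≤⇒0< 1≤z))
    0≤w′ = <⇒≤ (inv-pos (1≤⇒0< 1≤z′))
    w≤z = ≤-trans w≤1 1≤z
    w′≤z′ = ≤-trans w′≤1 1≤z′
    w′≤w = inv-anti-≤ (1≤⇒0< 1≤z) z≤z′
    0≤d = 0≤q-p z≤z′
    0≤d² = 0≤p² d
    -- For z ≥ 1 the maps 1/z and ½(z - 1/z) are 1-Lipschitz, so neither increment exceeds `d`.
    Δw≤d : w - w′ ≤ d
    Δw≤d = begin
      w - w′      ≡⟨ inverse-difference z w z′ w′ zw≡1 z′w′≡1 ⟩
      w * w′ * d  ≤⟨ *-monoʳ-≤-nonNeg d {{nonNegative 0≤d}} (*-mono-≤ 0≤w (nonNegative⁻¹ 1ℚ) w≤1 w′≤1) ⟩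
      1ℚ * d      ≡⟨ *-identityˡ d ⟩
      d           ∎
    Δg : g′ - g ≡ ½ * (d + (w - w′))
    Δg = solve 4 (λ z w z′ w′ → con ½ :* (z′ :- w′) :- con ½ :* (z :- w) :=
           con ½ :* ((z′ :- z) :+ (w :- w′))) refl z w z′ w′
    Δg≤d : g′ - g ≤ d
    Δg≤d = begin
      g′ - g             ≡⟨ Δg ⟩
      ½ * (d + (w - w′)) ≤⟨ *-monoˡ-≤-nonNeg ½ (+-monoʳ-≤ d Δw≤d) ⟩
      ½ * (d + d)        ≡⟨ *-distribˡ-+ ½ d d ⟩
      ½ * d + ½ * d      ≡⟨ ½+½ d ⟩
      d                  ∎
    g≤g′ : g ≤ g′
    g≤g′ = *-monoˡ-≤-nonNeg ½ (+-mono-≤ z≤z′ (neg-antimono-≤ w′≤w))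
    remainder : ∣ (g′ - g) * arctan′ g - 2ℚ * ((w - w′) * arctan′ w) ∣ ≤ d * d
    remainder = begin
      ∣ (g′ - g) * arctan′ g - 2ℚ * ((w - w′) * arctan′ w) ∣
        ≡⟨ cong ∣_∣ (slope-cancellation z w z′ w′ (arctan′ g) (arctan′ w) zw≡1 z′w′≡1 (arctan′-inverse g) (arctan′-inverse w)) ⟩
      ∣ ½ * (d * d) * (w′ * arctan′ g) ∣
        ≡⟨ 0≤p⇒∣p∣≡p (0≤-* (0≤-* {½} (nonNegative⁻¹ ½) 0≤d²) (0≤-* 0≤w′ (<⇒≤ (0<arctan′ g)))) ⟩
      ½ * (d * d) * (w′ * arctan′ g)
        ≤⟨ *-mono-≤ (0≤-* {½} (nonNegative⁻¹ ½) 0≤d²) (nonNegative⁻¹ 1ℚ) (½*-≤ 0≤d²)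
             (*-mono-≤ 0≤w′ (nonNegative⁻¹ 1ℚ) w′≤1 (arctan′≤1 g)) ⟩
      d * d * 1ℚ
        ≡⟨ *-identityʳ (d * d) ⟩
      d * d ∎

  telescope : ∀ (f : ℕ → ℚ) N {c} → (∀ i → i ℕ.< N → ∣ f (suc i) - f i ∣ ≤ c) →
              ∣ f N - f 0 ∣ ≤ fromℕ N * c
  telescope f zero {c} _ = ≤-reflexive (trans (cong ∣_∣ (+-inverseʳ (f 0))) (sym (*-zeroˡ c)))
  telescope f (suc N) {c} step = begin
    ∣ f (suc N) - f 0 ∣                  ≤⟨ ∣-∣-triangle (f (suc N)) (f N) (f 0) ⟩
    ∣ f (suc N) - f N ∣ + ∣ f N - f 0 ∣  ≤⟨ +-mono-≤ (step N ℕₚ.≤-refl) (telescope f N (λ i i<N → step i (ℕₚ.m≤n⇒m≤1+n i<N))) ⟩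
    c + fromℕ N * c                      ≡⟨ solve 2 (λ N c → c :+ N :* c := (con 1ℚ :+ N) :* c) refl (fromℕ N) c ⟩
    (1ℚ + fromℕ N) * c                   ≡⟨ cong (_* c) (fromℕ-suc N) ⟨
    fromℕ (suc N) * c                    ∎

  -- Over N+1 steps of width (z - 1)/(N+1) the quadratic errors add up to O(1/N), whereas the
  -- discretisation error is incurred N+1 times. Keeping `N` and `n` independent allows the latter
  -- to be made small for fixed `N`.
  angle-constant : ∀ n N {z} → 1ℚ ≤ z →
    ∣ angle n z - angle n 1ℚ ∣ ≤
    fromℕ 7 * (z * z) * recip N + fromℕ (suc N) * (fromℕ 12 * (z * z)) * recip n
  angle-constant n N {z} 1≤z = begin
    ∣ angle n z - angle n 1ℚ ∣
      ≡⟨ cong₂ (λ x y → ∣ angle n x - angle n y ∣) last first ⟨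
    ∣ angle n (grid (suc N)) - angle n (grid 0) ∣
      ≤⟨ telescope (λ i → angle n (grid i)) (suc N) step ⟩
    fromℕ (suc N) * (fromℕ 7 * (h * h) + fromℕ 12 * (z * z) * recip n)
      ≡⟨ solve 7 (λ S δ r z s a b → S :* (a :* ((δ :* r) :* (δ :* r)) :+ b :* (z :* z) :* s) :=
           S :* r :* (a :* (δ :* δ) :* r) :+ S :* (b :* (z :* z)) :* s)
           refl (fromℕ (suc N)) (z - 1ℚ) (recip N) z (recip n) (fromℕ 7) (fromℕ 12) ⟩
    fromℕ (suc N) * recip N * (fromℕ 7 * (δ * δ) * recip N) + rest
      ≡⟨ cong (_+ rest) (*-cancel-inverse (fromℕ (suc N)) (recip N) _ (fromℕ*recip N)) ⟩
    fromℕ 7 * (δ * δ) * recip N + rest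
      ≤⟨ +-monoˡ-≤ rest (*-monoʳ-≤-nonNeg (recip N) {{nonNegative (<⇒≤ (0<recip N))}}
           (*-monoˡ-≤-nonNeg (fromℕ 7) (square-mono-≤ 0≤δ (p-q≤p {z} (nonNegative⁻¹ 1ℚ))))) ⟩
    fromℕ 7 * (z * z) * recip N + rest ∎
    where
    δ = z - 1ℚ
    0≤δ = 0≤q-p 1≤z
    h = δ * recip N
    0≤h : 0ℚ ≤ h
    0≤h = 0≤-* 0≤δ (<⇒≤ (0<recip N))
    rest = fromℕ (suc N) * (fromℕ 12 * (z * z)) * recip n
    grid : ℕ → ℚ
    grid i = 1ℚ + fromℕ i * h
    first : grid 0 ≡ 1ℚ
    first = trans (cong (1ℚ +_) (*-zeroˡ h)) (+-identityʳ 1ℚ)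
    last : grid (suc N) ≡ z
    last = begin-equality
      1ℚ + fromℕ (suc N) * (δ * recip N)  ≡⟨ cong (1ℚ +_) (solve 3 (λ S δ r → S :* (δ :* r) := S :* r :* δ) refl (fromℕ (suc N)) δ (recip N)) ⟩
      1ℚ + fromℕ (suc N) * recip N * δ    ≡⟨ cong (1ℚ +_) (*-cancel-inverse (fromℕ (suc N)) (recip N) δ (fromℕ*recip N)) ⟩
      1ℚ + (z - 1ℚ)                       ≡⟨ p+[q-p] 1ℚ z ⟩
      z                                   ∎
    grid-mono : ∀ {i j} → i ℕ.≤ j → grid i ≤ grid j
    grid-mono i≤j = +-monoʳ-≤ 1ℚ (*-monoʳ-≤-nonNeg h {{nonNegative 0≤h}} (fromℕ-mono-≤ i≤j))
    width : ∀ i → grid (suc i) - grid i ≡ h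
    width i = trans (cong (λ x → (1ℚ + x * h) - grid i) (fromℕ-suc i))
      (solve 2 (λ i h → (con 1ℚ :+ (con 1ℚ :+ i) :* h) :- (con 1ℚ :+ i :* h) := h) refl (fromℕ i) h)
    step : ∀ i → i ℕ.< suc N →
      ∣ angle n (grid (suc i)) - angle n (grid i) ∣ ≤ fromℕ 7 * (h * h) + fromℕ 12 * (z * z) * recip n
    step i i<N = subst (λ x → ∣ angle n (grid (suc i)) - angle n (grid i) ∣ ≤ fromℕ 7 * (x * x) + fromℕ 12 * (z * z) * recip n)
      (width i)
      (angle-step n (subst (_≤ grid i) first (grid-mono {0} {i} ℕ.z≤n))
        (grid-mono (ℕₚ.n≤1+n i)) (subst (grid (suc i) ≤_) last (grid-mono i<N)))

  arctan-approx-0 : ∀ n → arctan-approx n 0ℚ ≡ 0ℚ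
  arctan-approx-0 n = begin-equality
    Σ[ i < suc n ] (0ℚ * recip n * arctan′ (fromℕ i * (0ℚ * recip n)))
      ≡⟨ Σ-cong (suc n) (λ i → trans (cong (_* arctan′ (fromℕ i * (0ℚ * recip n))) (*-zeroˡ (recip n)))
           (*-zeroˡ (arctan′ (fromℕ i * (0ℚ * recip n))))) ⟩
    Σ[ i < suc n ] 0ℚ   ≡⟨ Σ-const (suc n) 0ℚ ⟩
    fromℕ (suc n) * 0ℚ  ≡⟨ *-zeroʳ (fromℕ (suc n)) ⟩
    0ℚ                  ∎

  -- `cot2 1ℚ (inv 1ℚ)` evaluates to `0ℚ`, so the first arctangent vanishes.
  angle-1 : ∀ n → angle n 1ℚ ≡ 2ℚ * arctan-approx n 1ℚ
  angle-1 n = trans (cong (_+ 2ℚ * arctan-approx n 1ℚ) (arctan-approx-0 n)) (+-identityˡ _)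

  -- Powers and Binet's formula with an error term.

  1^n≡1 : ∀ n → 1ℚ ^ n ≡ 1ℚ
  1^n≡1 zero    = refl
  1^n≡1 (suc n) = trans (*-identityˡ (1ℚ ^ n)) (1^n≡1 n)

  [-1]^odd : ∀ k → (- 1ℚ) ^ (2 ℕ.* k ℕ.+ 1) ≡ - 1ℚ
  [-1]^odd k = begin-equality
    (- 1ℚ) ^ (2 ℕ.* k ℕ.+ 1)       ≡⟨ ^-homo-* (- 1ℚ) (2 ℕ.* k) 1 ⟩
    -- After regrouping the exponent, `(- 1ℚ) ^ 2` evaluates to `1ℚ`.
    (- 1ℚ) ^ (2 ℕ.* k) * - 1ℚ      ≡⟨ cong (_* - 1ℚ) (^-assocʳ (- 1ℚ) 2 k) ⟨
    1ℚ ^ k * - 1ℚ                  ≡⟨ cong (_* - 1ℚ) (1^n≡1 k) ⟩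
    - 1ℚ                           ∎

  1≤^ : ∀ {p} n → 1ℚ ≤ p → 1ℚ ≤ p ^ n
  1≤^     zero    1≤p = ≤-refl
  1≤^ {p} (suc n) 1≤p = *-mono-≤ {1ℚ} {p} {1ℚ} (nonNegative⁻¹ 1ℚ) (≤-trans (nonNegative⁻¹ 1ℚ) (1≤^ n 1≤p)) 1≤p (1≤^ n 1≤p)

  ∣^∣-mono-≤ : ∀ {p b} n → ∣ p ∣ ≤ b → ∣ p ^ n ∣ ≤ b ^ n
  ∣^∣-mono-≤         zero    p≤b = ≤-refl
  ∣^∣-mono-≤ {p} {b} (suc n) p≤b = subst (_≤ b * b ^ n) (sym (∣p*q∣≡∣p∣*∣q∣ p (p ^ n)))
    (*-mono-≤ (0≤∣p∣ p) (≤-trans (0≤∣p∣ (p ^ n)) (∣^∣-mono-≤ n p≤b)) p≤b (∣^∣-mono-≤ n p≤b))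

  -- An odd power lets the sign pass through, so -(-y)ⁿ is yⁿ. The sign stays inside the power
  -- because Binet's formula involves powers of the conjugate, here `- y`. This is where the parity
  -- of the exponent enters.
  odd-power-inverse : ∀ k {x y} → x * y ≡ 1ℚ → let n = 2 ℕ.* k ℕ.+ 1 in
    x ^ n * (- ((- y) ^ n)) ≡ 1ℚ
  odd-power-inverse k {x} {y} xy≡1 = begin-equality
    x ^ n * (- ((- y) ^ n))   ≡⟨ neg-distribʳ-* (x ^ n) ((- y) ^ n) ⟨
    - (x ^ n * (- y) ^ n)     ≡⟨ cong -_ (^-distrib-* x (- y) n) ⟨
    - ((x * - y) ^ n)         ≡⟨ cong (λ p → - (p ^ n)) (trans (sym (neg-distribʳ-* x y)) (cong -_ xy≡1)) ⟩
    - ((- 1ℚ) ^ n)            ≡⟨ cong -_ ([-1]^odd k) ⟩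
    1ℚ                        ∎
    where n = 2 ℕ.* k ℕ.+ 1

  -- In the application x ≈ φ and y = 1/x, so that - y ≈ 1 - φ.
  lucas-defect : ℕ → ℚ → ℚ → ℚ
  lucas-defect n x y = x ^ n + (- y) ^ n - fromℕ (lucas n)

  -- Both `x` and `- y` satisfy the Lucas recurrence up to a multiple of x² - x - 1: for `- y` the
  -- deviation is y² + y - 1, which equals -y²(x² - x - 1) when xy = 1.
  lucas-defect-rec : ∀ n x y → x * y ≡ 1ℚ →
    lucas-defect (suc (suc n)) x y ≡
    lucas-defect (suc n) x y + lucas-defect n x y +
    (x ^ n - (- y) ^ n * (y * y)) * (x * x - x - 1ℚ)
  lucas-defect-rec n x y xy≡1 = begin-equality
    x * (x * X) + (- y) * ((- y) * Y) - fromℕ (lucas (suc n) ℕ.+ lucas n)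
      ≡⟨ cong (λ l → x * (x * X) + (- y) * ((- y) * Y) - l) (fromℕ-+ (lucas (suc n)) (lucas n)) ⟩
    x * (x * X) + (- y) * ((- y) * Y) - (L′ + L)
      ≡⟨ solve 6 (λ x y X Y L′ L →
           x :* (x :* X) :+ (:- y) :* ((:- y) :* Y) :- (L′ :+ L) :=
           (x :* X :+ (:- y) :* Y :- L′) :+ (X :+ Y :- L) :+
           (X :* (x :* x :- x :- con 1ℚ) :+ Y :* (y :* y :+ con 1ℚ :* y :- con 1ℚ)))
           refl x y X Y L′ L ⟩
    (x * X + (- y) * Y - L′) + (X + Y - L) +
    (X * (x * x - x - 1ℚ) + Y * (y * y + 1ℚ * y - 1ℚ))
      ≡⟨ cong (λ p → (x * X + (- y) * Y - L′) + (X + Y - L) + (X * (x * x - x - 1ℚ) + p)) tail ⟩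
    (x * X + (- y) * Y - L′) + (X + Y - L) +
    (X * (x * x - x - 1ℚ) + Y * (y * y + x * y * y - x * y * (x * y)))
      ≡⟨ solve 6 (λ x y X Y u v →
           u :+ v :+ (X :* (x :* x :- x :- con 1ℚ) :+ Y :* (y :* y :+ x :* y :* y :- x :* y :* (x :* y))) :=
           u :+ v :+ (X :- Y :* (y :* y)) :* (x :* x :- x :- con 1ℚ))
           refl x y X Y (x * X + (- y) * Y - L′) (X + Y - L) ⟩
    (x * X + (- y) * Y - L′) + (X + Y - L) + (X - Y * (y * y)) * (x * x - x - 1ℚ) ∎
    where
    X = x ^ n
    Y = (- y) ^ n
    L′ = fromℕ (lucas (suc n))
    L = fromℕ (lucas n)
    -- The factor in `1ℚ * y` was kept, and the last `1ℚ` is read as 1·1, so that one substitution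
    -- of xy for 1 makes the expression divisible by x² - x - 1.
    tail : Y * (y * y + 1ℚ * y - 1ℚ) ≡ Y * (y * y + x * y * y - x * y * (x * y))
    tail = sym (cong (λ p → Y * (y * y + p * y - p * p)) xy≡1)

  -- Follows `lucas-defect-rec` with the coefficient replaced by its bound for |x| ≤ 2 and |y| ≤ 1.
  -- The initial values come from the defects 1 + 1 - 2 = 0 and x - y - 1 = y(x² - x - 1). For fixed
  -- n it is a constant, independent of the approximation `x` of φ.
  lucas-bound : ℕ → ℚ
  lucas-bound zero          = 0ℚ
  lucas-bound (suc zero)    = 1ℚ
  lucas-bound (suc (suc n)) = lucas-bound (suc n) + lucas-bound n + (2ℚ ^ n + 2ℚ ^ n)

  0≤2^n : ∀ n → 0ℚ ≤ 2ℚ ^ n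
  0≤2^n n = ≤-trans (0≤∣p∣ (2ℚ ^ n)) (∣^∣-mono-≤ {2ℚ} n ≤-refl)

  0≤lucas-bound : ∀ n → 0ℚ ≤ lucas-bound n
  0≤lucas-bound zero          = ≤-refl
  0≤lucas-bound (suc zero)    = nonNegative⁻¹ 1ℚ
  0≤lucas-bound (suc (suc n)) =
    0≤-+ (0≤-+ (0≤lucas-bound (suc n)) (0≤lucas-bound n)) (0≤-+ (0≤2^n n) (0≤2^n n))

  module _ {x y} (xy≡1 : x * y ≡ 1ℚ) (∣x∣≤2 : ∣ x ∣ ≤ 2ℚ) (∣y∣≤1 : ∣ y ∣ ≤ 1ℚ) where

    private
      e = x * x - x - 1ℚ
      instance
        _ = ∣-∣-nonNeg e

    coefficient-bound : ∀ n → ∣ x ^ n - (- y) ^ n * (y * y) ∣ ≤ 2ℚ ^ n + 2ℚ ^ n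
    coefficient-bound n = begin
      ∣ x ^ n - (- y) ^ n * (y * y) ∣       ≤⟨ ∣p-q∣≤∣p∣+∣q∣ (x ^ n) ((- y) ^ n * (y * y)) ⟩
      ∣ x ^ n ∣ + ∣ (- y) ^ n * (y * y) ∣   ≡⟨ cong (∣ x ^ n ∣ +_) (∣p*q∣≡∣p∣*∣q∣ ((- y) ^ n) (y * y)) ⟩
      ∣ x ^ n ∣ + ∣ (- y) ^ n ∣ * ∣ y * y ∣ ≤⟨ +-mono-≤ (∣^∣-mono-≤ n ∣x∣≤2)
                                                 (*-mono-≤ (0≤∣p∣ ((- y) ^ n)) (nonNegative⁻¹ 1ℚ)
                                                   (∣^∣-mono-≤ n ∣-y∣≤2) (∣*∣≤1 {y} {y} ∣y∣≤1 ∣y∣≤1)) ⟩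
      2ℚ ^ n + 2ℚ ^ n * 1ℚ                  ≡⟨ cong (2ℚ ^ n +_) (*-identityʳ (2ℚ ^ n)) ⟩
      2ℚ ^ n + 2ℚ ^ n                       ∎
      where
      ∣-y∣≤2 : ∣ - y ∣ ≤ 2ℚ
      ∣-y∣≤2 = subst (_≤ 2ℚ) (sym (∣-p∣≡∣p∣ y)) (≤-trans ∣y∣≤1 (fromℕ-mono-≤ {1} {2} (ℕ.s≤s ℕ.z≤n)))

    ∣lucas-defect∣≤ : ∀ n → ∣ lucas-defect n x y ∣ ≤ lucas-bound n * ∣ e ∣
    ∣lucas-defect∣≤ zero = ≤-reflexive (sym (*-zeroˡ ∣ e ∣))
    ∣lucas-defect∣≤ (suc zero) = begin
      ∣ x * 1ℚ + (- y) * 1ℚ - 1ℚ ∣  ≡⟨ cong ∣_∣ (solve 2 (λ x y →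
          x :* con 1ℚ :+ (:- y) :* con 1ℚ :- con 1ℚ := con 1ℚ :* x :- y :- con 1ℚ) refl x y) ⟩
      ∣ 1ℚ * x - y - 1ℚ ∣           ≡⟨ cong (λ p → ∣ p * x - y - p ∣) xy≡1 ⟨
      ∣ x * y * x - y - x * y ∣     ≡⟨ cong ∣_∣ (solve 2 (λ x y →
          x :* y :* x :- y :- x :* y := y :* (x :* x :- x :- con 1ℚ)) refl x y) ⟩
      ∣ y * e ∣                     ≡⟨ ∣p*q∣≡∣p∣*∣q∣ y e ⟩
      ∣ y ∣ * ∣ e ∣                 ≤⟨ *-monoʳ-≤-nonNeg ∣ e ∣ ∣y∣≤1 ⟩
      1ℚ * ∣ e ∣                    ∎
    ∣lucas-defect∣≤ (suc (suc n)) = begin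
      ∣ lucas-defect (suc (suc n)) x y ∣
        ≡⟨ cong ∣_∣ (lucas-defect-rec n x y xy≡1) ⟩
      ∣ u₁ + u₀ + c * e ∣
        ≤⟨ ∣p+q∣≤∣p∣+∣q∣ (u₁ + u₀) (c * e) ⟩
      ∣ u₁ + u₀ ∣ + ∣ c * e ∣
        ≤⟨ +-mono-≤ (∣p+q∣≤∣p∣+∣q∣ u₁ u₀) (≤-reflexive (∣p*q∣≡∣p∣*∣q∣ c e)) ⟩
      ∣ u₁ ∣ + ∣ u₀ ∣ + ∣ c ∣ * ∣ e ∣
        ≤⟨ +-mono-≤ (+-mono-≤ (∣lucas-defect∣≤ (suc n)) (∣lucas-defect∣≤ n))
             (*-monoʳ-≤-nonNeg ∣ e ∣ (coefficient-bound n)) ⟩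
      lucas-bound (suc n) * ∣ e ∣ + lucas-bound n * ∣ e ∣ + (2ℚ ^ n + 2ℚ ^ n) * ∣ e ∣
        ≡⟨ solve 4 (λ a b c e → a :* e :+ b :* e :+ c :* e := (a :+ b :+ c) :* e) refl
             (lucas-bound (suc n)) (lucas-bound n) (2ℚ ^ n + 2ℚ ^ n) ∣ e ∣ ⟩
      lucas-bound (suc (suc n)) * ∣ e ∣ ∎
      where
      u₁ = lucas-defect (suc n) x y
      u₀ = lucas-defect n x y
      c = x ^ n - (- y) ^ n * (y * y)

  -- Rational approximations of √5 and φ.

  recip≤1 : ∀ n → recip n ≤ 1ℚ
  recip≤1 n = subst₂ _≤_ (*-identityˡ (recip n)) (fromℕ*recip n)
    (*-monoʳ-≤-nonNeg (recip n) (fromℕ-mono-≤ {1} {suc n} (ℕ.s≤s ℕ.z≤n)))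

  fromℕ-scaled-square : ∀ k n → fromℕ (k ℕ.* (suc n ℕ.* suc n)) * (recip n * recip n) ≡ fromℕ k
  fromℕ-scaled-square k n = begin-equality
    fromℕ (k ℕ.* (suc n ℕ.* suc n)) * (r * r)
      ≡⟨ cong (_* (r * r)) (trans (fromℕ-* k (suc n ℕ.* suc n)) (cong (fromℕ k *_) (fromℕ-* (suc n) (suc n)))) ⟩
    fromℕ k * (N * N) * (r * r)
      ≡⟨ solve 3 (λ k N r → k :* (N :* N) :* (r :* r) := N :* r :* (N :* r :* k)) refl (fromℕ k) N r ⟩
    N * r * (N * r * fromℕ k)
      ≡⟨ *-cancel-inverse N r _ (fromℕ*recip n) ⟩
    N * r * fromℕ k
      ≡⟨ *-cancel-inverse N r _ (fromℕ*recip n) ⟩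
    fromℕ k ∎
    where
    N = fromℕ (suc n)
    r = recip n

  -- The lower half of `isqrt-spec`, divided by (n+1)²; the upper half is treated likewise in
  -- `≤⟨√-approx+recip⟩²`.
  √-approx²≤ : ∀ k n → √-approx k n * √-approx k n ≤ fromℕ k
  √-approx²≤ k n = subst₂ _≤_
    (trans (cong (_* (r * r)) (fromℕ-* a a))
      (solve 2 (λ a r → a :* a :* (r :* r) := a :* r :* (a :* r)) refl (fromℕ a) r))
    (fromℕ-scaled-square k n)
    (*-monoʳ-≤-nonNeg (r * r) {{nonNegative (0≤p² r)}}
      (fromℕ-mono-≤ (proj₁ (isqrt-spec (k ℕ.* (suc n ℕ.* suc n))))))
    where
    a = isqrt (k ℕ.* (suc n ℕ.* suc n))
    r = recip n

  ≤⟨√-approx+recip⟩² : ∀ k n → fromℕ k ≤ (√-approx k n + recip n) * (√-approx k n + recip n)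
  ≤⟨√-approx+recip⟩² k n = subst₂ _≤_
    (fromℕ-scaled-square k n)
    (trans (cong (_* (r * r)) (trans (fromℕ-* (suc a) (suc a)) (cong₂ _*_ (fromℕ-suc a) (fromℕ-suc a))))
      (solve 2 (λ a r → (con 1ℚ :+ a) :* (con 1ℚ :+ a) :* (r :* r) := (a :* r :+ r) :* (a :* r :+ r))
        refl (fromℕ a) r))
    (*-monoʳ-≤-nonNeg (r * r) {{nonNegative (0≤p² r)}}
      (fromℕ-mono-≤ (ℕₚ.<⇒≤ (proj₂ (isqrt-spec (k ℕ.* (suc n ℕ.* suc n)))))))
    where
    a = isqrt (k ℕ.* (suc n ℕ.* suc n))
    r = recip n

  -- Comparison with index 0, where the approximation is `isqrt 5`, that is 2, and `recip 0` is 1.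
  √5≤3 : ∀ n → √-approx 5 n ≤ fromℕ 3
  √5≤3 n = <⇒≤ (√-approx-< 5 n 0)

  1≤√5 : ∀ n → 1ℚ ≤ √-approx 5 n
  1≤√5 n = begin
    -- Here `1ℚ` is 2 - 1: the approximation at index 0 minus the bound on `recip n`.
    1ℚ                          ≤⟨ +-mono-≤ (<⇒≤ (√-approx-< 5 0 n)) (neg-antimono-≤ (recip≤1 n)) ⟩
    √-approx 5 n + recip n - recip n  ≡⟨ solve 2 (λ s r → s :+ r :- r := s) refl (√-approx 5 n) (recip n) ⟩
    √-approx 5 n                ∎

  ∣√5²-5∣≤ : ∀ n → ∣ √-approx 5 n * √-approx 5 n - fromℕ 5 ∣ ≤ fromℕ 7 * recip n
  ∣√5²-5∣≤ n = ∣∣-≤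
    (begin
      s * s - fromℕ 5    ≤⟨ +-monoˡ-≤ (- fromℕ 5) (√-approx²≤ 5 n) ⟩
      fromℕ 5 - fromℕ 5  ≤⟨ 0≤-* (0≤fromℕ 7) (<⇒≤ (0<recip n)) ⟩
      fromℕ 7 * r        ∎)
    (begin
      - (s * s - fromℕ 5)          ≡⟨ solve 2 (λ s f → :- (s :* s :- f) := f :- s :* s) refl s (fromℕ 5) ⟩
      fromℕ 5 - s * s              ≤⟨ +-monoˡ-≤ (- (s * s)) (≤⟨√-approx+recip⟩² 5 n) ⟩
      (s + r) * (s + r) - s * s    ≡⟨ solve 2 (λ s r → (s :+ r) :* (s :+ r) :- s :* s := (con 2ℚ :* s :+ r) :* r) refl s r ⟩
      -- The constant 7 is 2·3 + 1, from s ≤ 3 and r ≤ 1.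
      (2ℚ * s + r) * r             ≤⟨ *-monoʳ-≤-nonNeg r (+-mono-≤ (*-monoˡ-≤-nonNeg 2ℚ (√5≤3 n)) (recip≤1 n)) ⟩
      (2ℚ * fromℕ 3 + 1ℚ) * r      ≡⟨⟩
      fromℕ 7 * r                  ∎)
    where
    s = √-approx 5 n
    r = recip n

  1≤φ : ∀ n → 1ℚ ≤ seq φ n
  1≤φ n = *-monoˡ-≤-nonNeg ½ (+-monoʳ-≤ 1ℚ (1≤√5 n))

  φ≤2 : ∀ n → seq φ n ≤ 2ℚ
  φ≤2 n = *-monoˡ-≤-nonNeg ½ (+-monoʳ-≤ 1ℚ (√5≤3 n))

  -- For x = ½(1 + s), x² - x - 1 = ¼(s² - 5); the factor ¼ is then given away.
  ∣φ²-φ-1∣≤ : ∀ n → ∣ seq φ n * seq φ n - seq φ n - 1ℚ ∣ ≤ fromℕ 7 * recip n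
  ∣φ²-φ-1∣≤ n = begin
    ∣ seq φ n * seq φ n - seq φ n - 1ℚ ∣
      ≡⟨ cong ∣_∣ (solve 1 (λ s → let x = con ½ :* (con 1ℚ :+ s) in
           x :* x :- x :- con 1ℚ := con ½ :* (con ½ :* (s :* s :- con (fromℕ 5)))) refl s) ⟩
    ∣ ½ * (½ * (s * s - fromℕ 5)) ∣
      ≡⟨ trans (∣p*q∣≡∣p∣*∣q∣ ½ (½ * (s * s - fromℕ 5))) (cong (½ *_) (∣p*q∣≡∣p∣*∣q∣ ½ (s * s - fromℕ 5))) ⟩
    ½ * (½ * ∣ s * s - fromℕ 5 ∣)
      ≤⟨ ½*-≤ (0≤-* {½} (nonNegative⁻¹ ½) (0≤∣p∣ (s * s - fromℕ 5))) ⟩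
    ½ * ∣ s * s - fromℕ 5 ∣
      ≤⟨ ½*-≤ (0≤∣p∣ (s * s - fromℕ 5)) ⟩
    ∣ s * s - fromℕ 5 ∣
      ≤⟨ ∣√5²-5∣≤ n ⟩
    fromℕ 7 * recip n ∎
    where s = √-approx 5 n

  -- Comparison of the two sides at a fixed index, and the limit.

  seq-^ : ∀ x n m → seq (x ^ᵣ n) m ≡ seq x m ^ n
  seq-^ x zero    m = refl
  seq-^ x (suc n) m = cong (seq x m *_) (seq-^ x n m)

  fromℕ-half : ∀ n → ℤ.+ n / 2 ≡ ½ * fromℕ n
  fromℕ-half n = cong (_/ 2) (sym (ℤₚ.*-identityˡ (ℤ.+ n)))

  module _ (k m : ℕ) where

    private
      n = 2 ℕ.* k ℕ.+ 1
      F = arctan-approx m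
      x = seq φ m
      y = inv x
      z = x ^ n
      w = inv z
      L = fromℕ (lucas n)

      xy≡1 : x * y ≡ 1ℚ
      xy≡1 = inv-inverseʳ (1≤⇒0< (1≤φ m))

      ∣x∣≤2 : ∣ x ∣ ≤ 2ℚ
      ∣x∣≤2 = subst (_≤ 2ℚ) (sym (0≤p⇒∣p∣≡p (<⇒≤ (1≤⇒0< (1≤φ m))))) (φ≤2 m)

      ∣y∣≤1 : ∣ y ∣ ≤ 1ℚ
      ∣y∣≤1 = subst (_≤ 1ℚ) (sym (0≤p⇒∣p∣≡p (<⇒≤ (inv-pos (1≤⇒0< (1≤φ m)))))) (inv≤1 (1≤φ m))

      1≤z : 1ℚ ≤ z
      1≤z = 1≤^ n (1≤φ m)

      z²≤ : z * z ≤ 2ℚ ^ n * 2ℚ ^ n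
      z²≤ = subst (_≤ 2ℚ ^ n * 2ℚ ^ n) (∣∣-square z)
        (square-mono-≤ (0≤∣p∣ z) (∣^∣-mono-≤ n ∣x∣≤2))

      -- Turns z - w into xⁿ + (-y)ⁿ, the left side of Binet's formula.
      w≡ : w ≡ - ((- y) ^ n)
      w≡ = inverse-unique z w (- ((- y) ^ n)) (inv-inverseʳ (1≤⇒0< 1≤z)) (odd-power-inverse k xy≡1)

    -- The Lipschitz constant 2 cancels the ½ in `cot2` and in Lₙ/2, leaving exactly `lucas-defect`,
    -- which is O(1/m) because x² - x - 1 is.
    cot2-φ^n : ∣ F (cot2 z w) - F (ℤ.+ lucas n / 2) ∣ ≤ lucas-bound n * (fromℕ 7 * recip m)
    cot2-φ^n = begin
      ∣ F (cot2 z w) - F (ℤ.+ lucas n / 2) ∣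
        ≤⟨ arctan-approx-lipschitz m (cot2 z w) (ℤ.+ lucas n / 2) ⟩
      2ℚ * ∣ cot2 z w - ℤ.+ lucas n / 2 ∣
        ≡⟨ ∣p*q∣≡∣p∣*∣q∣ 2ℚ (cot2 z w - ℤ.+ lucas n / 2) ⟨
      ∣ 2ℚ * (cot2 z w - ℤ.+ lucas n / 2) ∣
        ≡⟨ cong₂ (λ w l → ∣ 2ℚ * (cot2 z w - l) ∣) w≡ (fromℕ-half (lucas n)) ⟩
      ∣ 2ℚ * (½ * (z - - ((- y) ^ n)) - ½ * L) ∣
        ≡⟨ cong ∣_∣ (solve 3 (λ z v l → con 2ℚ :* (con ½ :* (z :- :- v) :- con ½ :* l) := z :+ v :- l) refl z ((- y) ^ n) L) ⟩
      ∣ lucas-defect n x y ∣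
        ≤⟨ ∣lucas-defect∣≤ {x} {y} xy≡1 ∣x∣≤2 ∣y∣≤1 n ⟩
      lucas-bound n * ∣ x * x - x - 1ℚ ∣
        ≤⟨ *-monoˡ-≤-nonNeg (lucas-bound n) {{nonNegative (0≤lucas-bound n)}} (∣φ²-φ-1∣≤ m) ⟩
      lucas-bound n * (fromℕ 7 * recip m) ∎

    -- The error splits into that of Binet's formula and that of `angle-constant`. Bounding z by 2ⁿ
    -- makes the coefficients of `recip N` and `recip m` independent of m.
    discrepancy : ∀ N →
      ∣ ½ * (ℤ.+ 4 / 1 * F 1ℚ) - (F (ℤ.+ lucas n / 2) + ℤ.+ 2 / 1 * F (inv (seq (φ ^ᵣ n) m))) ∣ ≤
      fromℕ 7 * (2ℚ ^ n * 2ℚ ^ n) * recip N +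
      (fromℕ (suc N) * (fromℕ 12 * (2ℚ ^ n * 2ℚ ^ n)) + lucas-bound n * fromℕ 7) * recip m
    discrepancy N = begin
      ∣ ½ * (ℤ.+ 4 / 1 * F 1ℚ) - (F (ℤ.+ lucas n / 2) + 2ℚ * F (inv (seq (φ ^ᵣ n) m))) ∣
        ≡⟨ cong (λ z → ∣ ½ * (ℤ.+ 4 / 1 * F 1ℚ) - (F (ℤ.+ lucas n / 2) + 2ℚ * F (inv z)) ∣) (seq-^ φ n m) ⟩
      ∣ ½ * (ℤ.+ 4 / 1 * F 1ℚ) - (F (ℤ.+ lucas n / 2) + 2ℚ * F w) ∣
        -- Inserts `F (cot2 z w)`; since ½·4 = 2, the π side is 2 F(1), the value of `angle m` at 1.
        ≡⟨ cong ∣_∣ (solve 4 (λ o l w g →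
             con ½ :* (con (ℤ.+ 4 / 1) :* o) :- (l :+ con 2ℚ :* w) :=
             (g :- l) :- ((g :+ con 2ℚ :* w) :- con 2ℚ :* o)) refl (F 1ℚ) (F (ℤ.+ lucas n / 2)) (F w) (F (cot2 z w))) ⟩
      ∣ (F (cot2 z w) - F (ℤ.+ lucas n / 2)) - (angle m z - 2ℚ * F 1ℚ) ∣
        ≤⟨ ∣p-q∣≤∣p∣+∣q∣ (F (cot2 z w) - F (ℤ.+ lucas n / 2)) (angle m z - 2ℚ * F 1ℚ) ⟩
      ∣ F (cot2 z w) - F (ℤ.+ lucas n / 2) ∣ + ∣ angle m z - 2ℚ * F 1ℚ ∣
        ≡⟨ cong (λ t → ∣ F (cot2 z w) - F (ℤ.+ lucas n / 2) ∣ + ∣ angle m z - t ∣) (angle-1 m) ⟨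
      ∣ F (cot2 z w) - F (ℤ.+ lucas n / 2) ∣ + ∣ angle m z - angle m 1ℚ ∣
        ≤⟨ +-mono-≤ cot2-φ^n (≤-trans (angle-constant m N 1≤z) (+-mono-≤ coarse₁ coarse₂)) ⟩
      lucas-bound n * (fromℕ 7 * recip m) + (fromℕ 7 * β² * recip N + fromℕ (suc N) * (fromℕ 12 * β²) * recip m)
        ≡⟨ solve 5 (λ K s r a c → K :* (s :* r) :+ (a :+ c :* r) := a :+ (c :+ K :* s) :* r) refl
             (lucas-bound n) (fromℕ 7) (recip m) (fromℕ 7 * β² * recip N) (fromℕ (suc N) * (fromℕ 12 * β²)) ⟩
      fromℕ 7 * β² * recip N + (fromℕ (suc N) * (fromℕ 12 * β²) + lucas-bound n * fromℕ 7) * recip m ∎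
      where
      β² = 2ℚ ^ n * 2ℚ ^ n
      coarse₁ : fromℕ 7 * (z * z) * recip N ≤ fromℕ 7 * β² * recip N
      coarse₁ = *-monoʳ-≤-nonNeg (recip N) (*-monoˡ-≤-nonNeg (fromℕ 7) z²≤)
      coarse₂ : fromℕ (suc N) * (fromℕ 12 * (z * z)) * recip m ≤ fromℕ (suc N) * (fromℕ 12 * β²) * recip m
      coarse₂ = *-monoʳ-≤-nonNeg (recip m) (*-monoˡ-≤-nonNeg (fromℕ (suc N)) (*-monoˡ-≤-nonNeg (fromℕ 12) z²≤))

  half-π-identity : ∀ k → fromℚ ½ *ᵣ π ≃ᵣ
    arctan (fromℚ (ℤ.+ lucas (2 ℕ.* k ℕ.+ 1) / 2)) +ᵣ
    fromℚ (ℤ.+ 2 / 1) *ᵣ arctan (1/ᵣ (φ ^ᵣ (2 ℕ.* k ℕ.+ 1)))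
  half-π-identity k ε 0<ε = M , λ m M≤m → ≤-<-trans (discrepancy k m N)
    (subst (A * recip N + B * recip m <_) (½+½ ε)
      (+-mono-< (proj₂ coarse N ℕₚ.≤-refl) (proj₂ fine m M≤m)))
    where
    n = 2 ℕ.* k ℕ.+ 1
    β² = 2ℚ ^ n * 2ℚ ^ n
    A = fromℕ 7 * β²
    -- `N` is chosen from ε alone. The coefficient `B` grows with `N`, so the threshold `M` for m is
    -- chosen only afterwards; each term gets ε/2.
    coarse = recip-eventually-< A (0≤-* (0≤fromℕ 7) (0≤p² (2ℚ ^ n))) (0<½ 0<ε)
    N = proj₁ coarse
    B = fromℕ (suc N) * (fromℕ 12 * β²) + lucas-bound n * fromℕ 7
    fine = recip-eventually-< B
      (0≤-+ (0≤-* (0≤fromℕ (suc N)) (0≤-* (0≤fromℕ 12) (0≤p² (2ℚ ^ n)))) (0≤-* (0≤lucas-bound n) (0≤fromℕ 7)))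
      (0<½ 0<ε)
    M = proj₁ fine

open import Data.Nat using (ℕ; _+_; _*_)
open import Data.Integer using (+_)
open import Data.Rational using (½; _/_)

mainTheorem7 : ∀ (k : ℕ) →
    fromℚ ½ *ᵣ π ≃ᵣ
    arctan (fromℚ (+ lucas (2 * k + 1) / 2)) +ᵣ
    fromℚ (+ 2 / 1) *ᵣ arctan (1/ᵣ (φ ^ᵣ (2 * k + 1)))
mainTheorem7 = ArctangentLucas.half-π-identity
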